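{- Fix $n\ge1$ and a polynomial $h(x)=h_0+h_1x+\dots+h_{n+1}x^{n+1}$ with $h(1)\ne0$. Define $(a_k)_{k\ge0}$ by $\sum_{k\ge0}a_kx^k=h(x)/(1-x)^{n+1}$, and for each integer $b\ge1$ let $h^{\langle b\rangle}(x)$ be the polynomial of degree at most $n+1$ such that $\sum_{k\ge0}a_{bk}x^k=h^{\langle b\rangle}(x)/(1-x)^{n+1}$. Then, coefficientwise as $b\to\infty$, $$\frac{h^{\langle b\rangle}(x)}{b^n\,h(1)}\longrightarrow\frac{p_n(x)}{n!},$$ where $p_n(x)=\sum_{j\ge0}A(n,j)x^{j+1}$ is the $n$th Eulerian polynomial.
   Context: $A(n,j)$ is the number of permutations $\sigma\in S_n$ with exactly $j$ descents (a descent at $i$, $1\le i\le n-1$, means $\sigma(i+1)<\sigma(i)$). -}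

module Defs where

open import Level using (_⊔_) renaming (suc to lsuc)
open import Algebra.Apartness using (HeytingField; HeytingCommutativeRing)
open import Algebra.Bundles using (CommutativeRing; Semiring)
import Algebra.Apartness.Properties.HeytingCommutativeRing as HeytingProperties
import Algebra.Definitions.RawSemiring as RawSemiringDefinitions
import Algebra.Properties.AbelianGroup as AbelianGroupProperties
import Algebra.Properties.Ring as RingProperties
open import Data.Bool.Base using (if_then_else_)
open import Data.Fin.Base as Fin using (Fin; toℕ)
import Data.Fin.Properties as Fin
open import Data.List.Base as List using (List; length; filter; allFin; cartesianProductWith)
open import Data.Nat.Base as ℕ using (ℕ; zero; suc; NonZero; _!)
import Data.Nat.Properties as ℕ
open import Data.Product.Base using (∃-syntax; _,_; proj₁)
open import Data.Sum.Base using (_⊎_)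
open import Data.Vec.Base using (Vec; []; _∷_)
open import Data.Vec.Functional using (Vector; tail)
import Data.Vec.Functional.Relation.Binary.Equality.Setoid as VectorEquality
open import Data.Vec.Relation.Unary.AllPairs using (allPairs?)
open import Data.Vec.Relation.Unary.Unique.Propositional using (Unique)
open import Function.Bundles using (_⇔_; Equivalence)
open import Relation.Binary.Core using (Rel)
open import Relation.Binary.Structures using (IsStrictPartialOrder)
open import Relation.Nullary.Decidable using (Dec; does; ¬?)
open import Relation.Nullary.Negation using (¬_)

-- Eulerian numbers.  A permutation in Sₙ is written in one-line notation, as a
-- word of length n over Fin n with distinct letters.

words : ∀ k n → List (Vec (Fin k) n)
words k zero    = [] List.∷ List.[]
words k (suc n) = cartesianProductWith _∷_ (allFin k) (words k n)

unique? : ∀ {k n} (w : Vec (Fin k) n) → Dec (Unique w)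
unique? = allPairs? (λ x y → ¬? (x Fin.≟ y))

permutations : ∀ n → List (Vec (Fin n) n)
permutations n = filter unique? (words n n)

descents : ∀ {k n} → Vec (Fin k) n → ℕ
descents []          = 0
descents (x ∷ [])    = 0
descents (x ∷ y ∷ w) = (if does (y Fin.<? x) then 1 else 0) ℕ.+ descents (y ∷ w)

A : ℕ → ℕ → ℕ
A n j = length (filter (λ σ → descents σ ℕ.≟ j) (permutations n))

-- eulerianCoeff n k is the coefficient of xᵏ in pₙ(x) = Σⱼ A(n,j) xʲ⁺¹.
eulerianCoeff : ℕ → ℕ → ℕ
eulerianCoeff n zero    = 0
eulerianCoeff n (suc j) = A n j

module Field {c ℓ₁ ℓ₂} (F : HeytingField c ℓ₁ ℓ₂) where
  open HeytingField F public hiding (zero)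
  open HeytingCommutativeRing heytingCommutativeRing public using (commutativeRing)
  open CommutativeRing commutativeRing public using (semiring)
  open RawSemiringDefinitions (Semiring.rawSemiring semiring) public using (sum; _^_) renaming (_×_ to _·_)
  open HeytingProperties heytingCommutativeRing public using (x#0y#0→xy#0)

  fromℕ : ℕ → Carrier
  fromℕ n = n · 1#

  infixl 7 _/_[_]
  _/_[_] : Carrier → (y : Carrier) → y # 0# → Carrier
  x / y [ y#0 ] = x * proj₁ (#⇒invertible y#0)

-- The real numbers are a model.  Neither equality nor order is assumed to be
-- decidable; under excluded middle # is ≉ and these are the usual axioms.
record ArchimedeanOrderedField c ℓ₁ ℓ₂ ℓ₃ : Set (lsuc (c ⊔ ℓ₁ ⊔ ℓ₂ ⊔ ℓ₃)) where
  field
    heytingField : HeytingField c ℓ₁ ℓ₂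

  open Field heytingField public

  infix 4 _<_ _≤_
  field
    _<_                  : Rel Carrier ℓ₃
    isStrictPartialOrder : IsStrictPartialOrder _≈_ _<_
    #⇔<⊎>                : ∀ {x y} → x # y ⇔ (x < y ⊎ y < x)
    0<1                  : 0# < 1#
    +-monoʳ-<            : ∀ x {y z} → y < z → x + y < x + z
    *-positive           : ∀ {x y} → 0# < x → 0# < y → 0# < x * y
    archimedean          : ∀ x → ∃[ n ] x < fromℕ n

  _≤_ : Rel Carrier ℓ₃
  x ≤ y = ¬ (y < x)

-- A field with an absolute value that is the usual one on the natural numbers;
-- ∣fromℕ∣ rules out the trivial and the p-adic absolute values.  The real and
-- the complex numbers are models, with R the real numbers.
record ValuedField {c ℓ₁ ℓ₂ ℓ₃} (R : ArchimedeanOrderedField c ℓ₁ ℓ₂ ℓ₃) c′ ℓ₁′ ℓ₂′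
  : Set (c ⊔ ℓ₁ ⊔ ℓ₃ ⊔ lsuc (c′ ⊔ ℓ₁′ ⊔ ℓ₂′)) where
  private module R = ArchimedeanOrderedField R
  field
    heytingField : HeytingField c′ ℓ₁′ ℓ₂′

  open Field heytingField public

  field
    ∣_∣         : Carrier → R.Carrier
    ∣∣-cong     : ∀ {x y} → x ≈ y → ∣ x ∣ R.≈ ∣ y ∣
    ∣∣-nonneg   : ∀ x → R.0# R.≤ ∣ x ∣
    #0⇔∣∣>0     : ∀ {x} → x # 0# ⇔ R.0# R.< ∣ x ∣
    ∣∣-triangle : ∀ x y → ∣ x + y ∣ R.≤ ∣ x ∣ R.+ ∣ y ∣
    ∣∣-*        : ∀ x y → ∣ x * y ∣ R.≈ ∣ x ∣ R.* ∣ y ∣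
    ∣fromℕ∣     : ∀ n → ∣ fromℕ n ∣ R.≈ R.fromℕ n

module Analysis {c ℓ₁ ℓ₂ ℓ₃ c′ ℓ₁′ ℓ₂′}
  {R : ArchimedeanOrderedField c ℓ₁ ℓ₂ ℓ₃} (K : ValuedField R c′ ℓ₁′ ℓ₂′) where
  private module R = ArchimedeanOrderedField R
  open ValuedField K public
  open VectorEquality setoid public using (_≋_)
  open RingProperties (CommutativeRing.ring commutativeRing) using (-0#≈0#)
  open AbelianGroupProperties (CommutativeRing.+-abelianGroup commutativeRing) using (xyx⁻¹≈y)

  fromℕ#0 : ∀ n → .{{NonZero n}} → fromℕ n # 0#
  fromℕ#0 n = Equivalence.from #0⇔∣∣>0
    (R<.<-respʳ-≈ (R.sym (∣fromℕ∣ n)) (positive n))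
    where
    module R< = IsStrictPartialOrder R.isStrictPartialOrder
    positive : ∀ n → .{{NonZero n}} → R.0# R.< R.fromℕ n
    positive 1               = R<.<-respʳ-≈ (R.sym (R.+-identityʳ R.1#)) R.0<1
    positive (suc n@(suc _)) = R<.trans R.0<1
      (R<.<-respˡ-≈ (R.+-identityʳ R.1#) (R.+-monoʳ-< R.1# (positive n)))

  -- Sequences are indexed by the integers b ≥ 1.
  infix 3 _⟶_
  _⟶_ : ((b : ℕ) → .{{NonZero b}} → Carrier) → Carrier → Set (c ⊔ ℓ₃)
  u ⟶ ℓ = ∀ ε → R.0# R.< ε →
    ∃[ N ] (∀ b → .{{_ : NonZero b}} → N ℕ.≤ b → ∣ u b - ℓ ∣ R.< ε)

  -- Polynomials of degree at most d, by their coefficients in degrees 0, …, d.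
  Polynomial : ℕ → Set c′
  Polynomial d = Vector Carrier (suc d)

  eval : ∀ {d} → Polynomial d → Carrier → Carrier
  eval h x = sum (λ i → h i * x ^ toℕ i)

  coeff : ∀ {m} → Vector Carrier m → ℕ → Carrier
  coeff {zero}  h k       = 0#
  coeff {suc m} h zero    = h Fin.zero
  coeff {suc m} h (suc k) = coeff (tail h) k

  -- A formal power series, by its coefficients.
  Series : Set c′
  Series = ℕ → Carrier

  infixr 8 x·_ [1-x]·_ [1-x]^_·_

  x·_ : Series → Series
  (x· a) zero    = 0#
  (x· a) (suc k) = a k

  [1-x]·_ : Series → Series
  ([1-x]· a) k = a k - (x· a) k

  [1-x]^_·_ : ℕ → Series → Series
  [1-x]^ zero  · a = a
  [1-x]^ suc m · a = [1-x]^ m · ([1-x]· a)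

  -- Σₖ aₖ xᵏ = h(x) / (1-x)ᵐ, cleared of the (invertible) denominator.
  infix 4 _IsSeriesOf_/[1-x]^_
  _IsSeriesOf_/[1-x]^_ : ∀ {d} → Series → Polynomial d → ℕ → Set ℓ₁′
  a IsSeriesOf h /[1-x]^ m = ∀ k → ([1-x]^ m · a) k ≈ coeff h k

  -- Every h(x) / (1-x)ᵐ has an expansion: dividing by 1-x takes partial sums.
  expansion : ∀ {d} m (h : Polynomial d) → ∃[ a ] (a IsSeriesOf h /[1-x]^ m)
  expansion m h = divide m , divide-correct m
    where
    partialSums : Series → Series
    partialSums f zero    = f zero
    partialSums f (suc k) = partialSums f k + f (suc k)

    divide : ℕ → Series
    divide zero    = coeff h
    divide (suc m) = partialSums (divide m)

    [1-x]-cong : ∀ {f g} → (∀ k → f k ≈ g k) → ∀ k → ([1-x]· f) k ≈ ([1-x]· g) k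
    [1-x]-cong f≈g zero    = +-congʳ (f≈g zero)
    [1-x]-cong f≈g (suc k) = +-cong (f≈g (suc k)) (-‿cong (f≈g k))

    [1-x]^-cong : ∀ m {f g} → (∀ k → f k ≈ g k) → ∀ k → ([1-x]^ m · f) k ≈ ([1-x]^ m · g) k
    [1-x]^-cong zero    f≈g = f≈g
    [1-x]^-cong (suc m) f≈g = [1-x]^-cong m ([1-x]-cong f≈g)

    [1-x]-partialSums : ∀ f k → ([1-x]· partialSums f) k ≈ f k
    [1-x]-partialSums f zero    = trans (+-congˡ -0#≈0#) (+-identityʳ _)
    [1-x]-partialSums f (suc k) = xyx⁻¹≈y (partialSums f k) (f (suc k))

    divide-correct : ∀ m → divide m IsSeriesOf h /[1-x]^ m
    divide-correct zero    k = refl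
    divide-correct (suc m) k =
      trans ([1-x]^-cong m ([1-x]-partialSums (divide m)) k) (divide-correct m k)

-- Write Δ for forward and 1 - x for backward differences.  As deg h ≤ n + 1,
-- Δⁿa is constant, equal to h(1), away from k = 0, and then so is Δⁿ of
-- k ↦ a(bk), with value bⁿ h(1).  Hence a(k) / h(1) and kⁿ / n! have the same
-- n-th differences, they differ by O(kⁿ⁻¹), and a(bk) / (bⁿ h(1)) = kⁿ / n! + O(1/b)
-- for every fixed k.  Applying (1 - x)ⁿ⁺¹, which involves finitely many k for each
-- coefficient, reduces the limit to Worpitzky's identity: the coefficients of
-- (1 - x)ⁿ⁺¹ Σₖ kⁿ xᵏ are the Eulerian numbers.  For the latter, count permutations
-- of m + 1 letters by descents with first letter i prescribed: the generating
-- polynomial is (1 - x)ᵐ⁺¹ Σₖ kⁱ (k + 1)ᵐ⁻ⁱ xᵏ, by induction on removing the first letter.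

module Submission where

open import Defs
open import Algebra.Apartness using (HeytingField)
import Algebra.Apartness.Properties.HeytingCommutativeRing as HeytingProperties
open import Algebra.Bundles using (CommutativeRing; CommutativeMonoid)
import Algebra.Properties.AbelianGroup as AbelianGroupProperties
import Algebra.Properties.CommutativeSemigroup as CommutativeSemigroupProperties
import Algebra.Properties.Ring as RingProperties
import Algebra.Properties.Semiring.Mult as Multiples
import Algebra.Properties.Semiring.Sum as Sums
open import Data.Bool.Base using (Bool; true; false; _∧_; if_then_else_)
open import Data.Fin.Base as Fin using (Fin; toℕ; punchIn)
import Data.Fin.Properties as Fin
open import Data.List.Base as List using (List; []; _∷_; _++_; length; filter; cartesianProductWith)
import Data.List.Properties as List
import Data.List.Relation.Unary.All as ListAll
import Data.List.Relation.Unary.All.Properties as ListAll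
open import Data.Nat using (ℕ; suc; NonZero; _!)
open import Data.Nat as ℕ using (zero; z≤n; s≤s)
import Data.Nat.Properties as ℕ
open import Data.Nat.Properties using (m^n≢0; _!≢0)
open import Data.Nat.Solver using (module +-*-Solver)
open import Data.Product using (∃-syntax; ∃!; _×_; _,_; proj₁; proj₂)
open import Data.Sum using (_⊎_; inj₁; inj₂; [_,_]′)
open import Data.Vec.Base as Vec using (Vec; []; _∷_)
open import Data.Vec.Functional using (Vector; tail)
open import Data.Vec.Relation.Unary.All as All using (All; all?)
import Data.Vec.Relation.Unary.All.Properties as All
import Data.Vec.Relation.Unary.AllPairs as AllPairs
open import Data.Vec.Relation.Unary.Unique.Propositional using (Unique)
import Data.Vec.Relation.Unary.Unique.Propositional.Properties as Unique
open import Function using (_∘_; id; Equivalence)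
open import Level using (Level; _⊔_)
open import Relation.Binary.PropositionalEquality as ≡ using (_≡_; _≢_; _≗_)
import Relation.Binary.Reasoning.Setoid as ≈-Reasoning
open import Relation.Binary.Structures using (IsStrictPartialOrder)
open import Relation.Nullary using (Dec; does; ¬?; contradiction)
open import Relation.Unary using (Pred; Decidable)

open +-*-Solver using (solve; _:+_; _:*_; _:=_; con)

module EulerianNumbers where
  open import Data.Nat using (zero; _+_; _*_; _^_)
  open Sums ℕ.+-*-semiring using (sum; sum-cong-≗; ∑-distrib-+; *-distribˡ-sum)
  open ≡

  private variable
    ℓ p q : Level
    X Y Z : Set ℓ

  -- Filtering lists, their images and their products.

  filter-map : {P : Pred Y p} (P? : Decidable P) (f : X → Y) → ∀ xs →
    filter P? (List.map f xs) ≡ List.map f (filter (P? ∘ f) xs)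
  filter-map P? f []       = refl
  filter-map P? f (x ∷ xs) with does (P? (f x))
  ... | true  = cong (f x ∷_) (filter-map P? f xs)
  ... | false = filter-map P? f xs

  length-filter-map : {P : Pred Y p} (P? : Decidable P) (f : X → Y) → ∀ xs →
    length (filter P? (List.map f xs)) ≡ length (filter (P? ∘ f) xs)
  length-filter-map P? f xs = trans (cong length (filter-map P? f xs)) (List.length-map f (filter (P? ∘ f) xs))

  -- The hypothesis compares Boolean parts only: on a cons, `unique?` computes to a conjunction with
  -- `avoids?`, so `refl` discharges it. The same device serves `filter-cartesianProductWith`.
  filter-doubly : {P : Pred X p} {Q : Pred X q} (P? : Decidable P) (Q? : Decidable Q)
    {R : Pred X ℓ} (R? : Decidable R) →
    (∀ x → does (R? x) ≡ does (P? x) ∧ does (Q? x)) →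
    ∀ xs → filter R? xs ≡ filter Q? (filter P? xs)
  filter-doubly P? Q? R? eq []       = refl
  filter-doubly P? Q? R? eq (x ∷ xs) with does (P? x) | does (R? x) | eq x
  ... | false | false | _ = filter-doubly P? Q? R? eq xs
  ... | true  | r     | e with does (Q? x)
  ...   | true  rewrite e = cong (x ∷_) (filter-doubly P? Q? R? eq xs)
  ...   | false rewrite e = filter-doubly P? Q? R? eq xs

  map-cartesianProductWith : ∀ {w} {W : Set w} (g : Z → W) (f : X → Y → Z) → ∀ xs ys →
    List.map g (cartesianProductWith f xs ys) ≡ cartesianProductWith (λ x y → g (f x y)) xs ys
  map-cartesianProductWith g f []       ys = refl
  map-cartesianProductWith g f (x ∷ xs) ys = trans (List.map-++ g (List.map (f x) ys) _)
    (cong₂ _++_ (sym (List.map-∘ ys)) (map-cartesianProductWith g f xs ys))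

  cartesianProductWith-map : ∀ {v w} {V : Set v} {W : Set w} (f : X → Y → Z) (g : V → X) (h : W → Y) → ∀ xs ys →
    cartesianProductWith f (List.map g xs) (List.map h ys) ≡ cartesianProductWith (λ x y → f (g x) (h y)) xs ys
  cartesianProductWith-map f g h []       ys = refl
  cartesianProductWith-map f g h (x ∷ xs) ys =
    cong₂ _++_ (sym (List.map-∘ ys)) (cartesianProductWith-map f g h xs ys)

  filter-cartesianProductWith : {P : Pred X p} (P? : Decidable P) {Q : Pred Y q} (Q? : Decidable Q)
    {R : Pred Z ℓ} (R? : Decidable R) (f : X → Y → Z) →
    (∀ x y → does (R? (f x y)) ≡ does (P? x) ∧ does (Q? y)) →
    ∀ xs ys → filter R? (cartesianProductWith f xs ys) ≡ cartesianProductWith f (filter P? xs) (filter Q? ys)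
  filter-cartesianProductWith P? Q? R? f eq []       ys = refl
  filter-cartesianProductWith P? Q? R? f eq (x ∷ xs) ys =
    trans (List.filter-++ R? (List.map (f x) ys) (cartesianProductWith f xs ys))
      (trans (cong (filter R? (List.map (f x) ys) ++_) (filter-cartesianProductWith P? Q? R? f eq xs ys)) row)
    where
    rest = cartesianProductWith f (filter P? xs) (filter Q? ys)
    kept : does (P? x) ≡ true → ∀ ys → filter R? (List.map (f x) ys) ≡ List.map (f x) (filter Q? ys)
    kept Px []       = refl
    kept Px (y ∷ ys) rewrite eq x y | Px with does (Q? y)
    ... | true  = cong (f x y ∷_) (kept Px ys)
    ... | false = kept Px ys
    dropped : does (P? x) ≡ false → ∀ ys → filter R? (List.map (f x) ys) ≡ []
    dropped ¬Px []       = refl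
    dropped ¬Px (y ∷ ys) rewrite eq x y | ¬Px = dropped ¬Px ys
    row : filter R? (List.map (f x) ys) ++ rest ≡ cartesianProductWith f (filter P? (x ∷ xs)) (filter Q? ys)
    row with does (P? x) in Px
    ... | true  = cong (_++ rest) (kept Px ys)
    ... | false = cong (_++ rest) (dropped Px ys)

  -- Permutations by first letter.

  avoids? : ∀ {k n} (x : Fin k) (w : Vec (Fin k) n) → Dec (All (x ≢_) w)
  avoids? x = all? (λ y → ¬? (x Fin.≟ y))

  tabulate-suc : ∀ {n} → List.tabulate {n = n} Fin.suc ≡ List.map Fin.suc (List.allFin n)
  tabulate-suc = sym (List.map-tabulate (λ i → i) Fin.suc)

  -- `punchIn x` enumerates the letters other than `x` in increasing order, so the two lists agree
  -- in order as well as in content.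
  filter-≢-allFin : ∀ {m} (x : Fin (suc m)) →
    filter (λ y → ¬? (x Fin.≟ y)) (List.allFin (suc m)) ≡ List.map (punchIn x) (List.allFin m)
  filter-≢-allFin Fin.zero = trans (List.filter-all (λ y → ¬? (Fin.zero Fin.≟ y)) (ListAll.tabulate⁺ (λ _ ()))) tabulate-suc
  filter-≢-allFin {suc m} (Fin.suc x) = cong (Fin.zero ∷_) (begin
      filter (λ y → ¬? (Fin.suc x Fin.≟ y)) (List.tabulate {n = suc m} Fin.suc)
        ≡⟨ cong (filter (λ y → ¬? (Fin.suc x Fin.≟ y))) tabulate-suc ⟩
      filter (λ y → ¬? (Fin.suc x Fin.≟ y)) (List.map Fin.suc (List.allFin (suc m)))
        ≡⟨ filter-map (λ y → ¬? (Fin.suc x Fin.≟ y)) Fin.suc (List.allFin (suc m)) ⟩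
      List.map Fin.suc (filter (λ y → ¬? (Fin.suc x Fin.≟ Fin.suc y)) (List.allFin (suc m)))
        ≡⟨ cong (List.map Fin.suc) (List.filter-≐ (λ y → ¬? (Fin.suc x Fin.≟ Fin.suc y)) (λ y → ¬? (x Fin.≟ y))
             ((λ sx≢sy x≡y → sx≢sy (cong Fin.suc x≡y)) , (λ x≢y sx≡sy → x≢y (Fin.suc-injective sx≡sy))) (List.allFin (suc m))) ⟩
      List.map Fin.suc (filter (λ y → ¬? (x Fin.≟ y)) (List.allFin (suc m)))
        ≡⟨ cong (List.map Fin.suc) (filter-≢-allFin x) ⟩
      List.map Fin.suc (List.map (punchIn x) (List.allFin m))
        ≡⟨ List.map-∘ (List.allFin m) ⟨
      List.map (Fin.suc ∘ punchIn x) (List.allFin m)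
        ≡⟨ List.map-∘ (List.allFin m) ⟩
      List.map (punchIn (Fin.suc x)) (List.map Fin.suc (List.allFin m))
        ≡⟨ cong (List.map (punchIn (Fin.suc x))) tabulate-suc ⟨
      List.map (punchIn (Fin.suc x)) (List.tabulate Fin.suc) ∎)
    where open ≡-Reasoning

  filter-avoids : ∀ {m} (x : Fin (suc m)) l →
    filter (avoids? x) (words (suc m) l) ≡ List.map (Vec.map (punchIn x)) (words m l)
  filter-avoids x zero    = refl
  filter-avoids {m} x (suc l) = begin
    filter (avoids? x) (words (suc m) (suc l))
      ≡⟨ filter-cartesianProductWith (λ y → ¬? (x Fin.≟ y)) (avoids? x) (avoids? x) _∷_
           (λ _ _ → refl) (List.allFin (suc m)) (words (suc m) l) ⟩
    cartesianProductWith _∷_ (filter (λ y → ¬? (x Fin.≟ y)) (List.allFin (suc m))) (filter (avoids? x) (words (suc m) l))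
      ≡⟨ cong₂ (cartesianProductWith _∷_) (filter-≢-allFin x) (filter-avoids x l) ⟩
    cartesianProductWith _∷_ (List.map (punchIn x) (List.allFin m)) (List.map (Vec.map (punchIn x)) (words m l))
      ≡⟨ cartesianProductWith-map _∷_ (punchIn x) (Vec.map (punchIn x)) (List.allFin m) (words m l) ⟩
    cartesianProductWith (λ y w → punchIn x y ∷ Vec.map (punchIn x) w) (List.allFin m) (words m l)
      ≡⟨ map-cartesianProductWith (Vec.map (punchIn x)) _∷_ (List.allFin m) (words m l) ⟨
    List.map (Vec.map (punchIn x)) (words m (suc l)) ∎
    where open ≡-Reasoning

  unique-map⁻ : ∀ {k l n} (f : Fin k → Fin l) {w : Vec (Fin k) n} → Unique (Vec.map f w) → Unique w
  unique-map⁻ f {[]}    _                    = AllPairs.[]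
  unique-map⁻ f {_ ∷ _} (x∉w AllPairs.∷ w!) =
    All.map (λ fx≢fy x≡y → fx≢fy (cong f x≡y)) (All.map⁻ x∉w) AllPairs.∷ unique-map⁻ f w!

  prepend : ∀ {m n} → Fin (suc m) → Vec (Fin m) n → Vec (Fin (suc m)) (suc n)
  prepend x w = x ∷ Vec.map (punchIn x) w

  -- What follows a first letter `x` is a word avoiding `x`, that is, a relabelling by `punchIn x`
  -- of a word over one letter fewer; distinctness of letters passes both ways through an injective
  -- relabelling. All enumerations are lexicographic and `punchIn x` is increasing, hence an
  -- equality of lists and not merely up to order.
  permutations-suc : ∀ m → permutations (suc m) ≡ cartesianProductWith prepend (List.allFin (suc m)) (permutations m)
  permutations-suc m = go (List.allFin (suc m))
    where
    open ≡-Reasoning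
    ws = words (suc m) m
    row : ∀ x → filter unique? (List.map (x ∷_) ws) ≡ List.map (prepend x) (permutations m)
    row x = begin
      filter unique? (List.map (x ∷_) ws)
        ≡⟨ filter-map unique? (x ∷_) ws ⟩
      List.map (x ∷_) (filter (unique? ∘ (x ∷_)) ws)
        ≡⟨ cong (List.map (x ∷_)) (filter-doubly (avoids? x) unique? (unique? ∘ (x ∷_)) (λ _ → refl) ws) ⟩
      List.map (x ∷_) (filter unique? (filter (avoids? x) ws))
        ≡⟨ cong (List.map (x ∷_) ∘ filter unique?) (filter-avoids x m) ⟩
      List.map (x ∷_) (filter unique? (List.map (Vec.map (punchIn x)) (words m m)))
        ≡⟨ cong (List.map (x ∷_)) (filter-map unique? (Vec.map (punchIn x)) (words m m)) ⟩
      List.map (x ∷_) (List.map (Vec.map (punchIn x)) (filter (unique? ∘ Vec.map (punchIn x)) (words m m)))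
        ≡⟨ List.map-∘ _ ⟨
      List.map (prepend x) (filter (unique? ∘ Vec.map (punchIn x)) (words m m))
        ≡⟨ cong (List.map (prepend x)) (List.filter-≐ _ unique?
             (unique-map⁻ (punchIn x) , Unique.map⁺ (λ {y} {z} → Fin.punchIn-injective x y z)) (words m m)) ⟩
      List.map (prepend x) (permutations m) ∎
    go : ∀ xs → filter unique? (cartesianProductWith _∷_ xs ws) ≡ cartesianProductWith prepend xs (permutations m)
    go []       = refl
    go (x ∷ xs) = trans (List.filter-++ unique? (List.map (x ∷_) ws) _) (cong₂ _++_ (row x) (go xs))

  length-filter-cartesianProductWith : {P : Pred Z p} (P? : Decidable P) {n : ℕ} (f : X → Y → Z) (g : Fin n → X) → ∀ ys →
    length (filter P? (cartesianProductWith f (List.tabulate g) ys)) ≡ sum (λ i → length (filter (P? ∘ f (g i)) ys))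
  length-filter-cartesianProductWith P? {zero}  f g ys = refl
  length-filter-cartesianProductWith P? {suc n} f g ys =
    trans (cong length (List.filter-++ P? (List.map (f (g Fin.zero)) ys) _))
      (trans (List.length-++ (filter P? (List.map (f (g Fin.zero)) ys)))
        (cong₂ _+_ (length-filter-map P? (f (g Fin.zero)) ys)
          (length-filter-cartesianProductWith P? f (g ∘ Fin.suc) ys)))

  -- Descents, refined by the first letter.

  does-punchIn-mono-< : ∀ {m} (x : Fin (suc m)) y z → does (punchIn x y Fin.<? punchIn x z) ≡ does (y Fin.<? z)
  does-punchIn-mono-< Fin.zero    y           z           = refl
  does-punchIn-mono-< (Fin.suc x) Fin.zero    Fin.zero    = refl
  does-punchIn-mono-< (Fin.suc x) Fin.zero    (Fin.suc z) = refl
  does-punchIn-mono-< (Fin.suc x) (Fin.suc y) Fin.zero    = refl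
  does-punchIn-mono-< (Fin.suc x) (Fin.suc y) (Fin.suc z) = does-punchIn-mono-< x y z

  -- `punchIn x` fixes the letters below `x` and moves the others strictly above it. The comparison
  -- goes through `toℕ` because `x` and `y` belong to alphabets of different sizes.
  does-punchIn-< : ∀ {m} (x : Fin (suc m)) (y : Fin m) → does (punchIn x y Fin.<? x) ≡ does (toℕ y ℕ.<? toℕ x)
  does-punchIn-< Fin.zero    y           = refl
  does-punchIn-< (Fin.suc x) Fin.zero    = refl
  does-punchIn-< (Fin.suc x) (Fin.suc y) = does-punchIn-< x y

  descents-punchIn : ∀ {m n} (x : Fin (suc m)) (w : Vec (Fin m) n) → descents (Vec.map (punchIn x) w) ≡ descents w
  descents-punchIn x []          = refl
  descents-punchIn x (y ∷ [])    = refl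
  descents-punchIn x (y ∷ z ∷ w) = cong₂ (λ b d → (if b then 1 else 0) + d)
    (does-punchIn-mono-< x z y) (descents-punchIn x (z ∷ w))

  -- Multiplication by x on generating functions.
  shift : (ℕ → ℕ) → ℕ → ℕ
  shift f zero    = 0
  shift f (suc j) = f j

  count : (X → ℕ) → List X → ℕ → ℕ
  count d xs j = length (filter (λ x → d x ℕ.≟ j) xs)

  count-cong : {d d′ : X → ℕ} → d ≗ d′ → ∀ xs → count d xs ≗ count d′ xs
  count-cong d≗d′ xs j =
    cong length (List.filter-≐ _ _ ((λ {x} → trans (sym (d≗d′ x))) , (λ {x} → trans (d≗d′ x))) xs)

  count-suc : (d : X → ℕ) → ∀ xs → count (suc ∘ d) xs ≗ shift (count d xs)
  count-suc d xs zero    = cong length (List.filter-none (λ x → suc (d x) ℕ.≟ 0) (ListAll.universal (λ _ ()) xs))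
  count-suc d xs (suc j) = cong length (List.filter-≐ _ _ (ℕ.suc-injective , cong suc) xs)

  -- Permutations of m + 1 letters, counted with first letter i.
  refined : ∀ m → Fin (suc m) → ℕ → ℕ
  refined m i = count (descents ∘ prepend i) (permutations m)

  -- A least letter put in front of a word creates no descent.
  A≡refined : ∀ m j → A m j ≡ refined m Fin.zero j
  A≡refined m = count-cong (λ σ → sym (descents-prepend-zero σ)) (permutations m)
    where
    descents-prepend-zero : ∀ {n} (σ : Vec (Fin m) n) → descents (prepend Fin.zero σ) ≡ descents σ
    descents-prepend-zero []      = refl
    descents-prepend-zero (x ∷ σ) = descents-punchIn Fin.zero (x ∷ σ)

  infix 4 _≺_
  _≺_ : ∀ {m n} → Fin m → Fin n → Bool
  i ≺ j = does (toℕ i ℕ.<? toℕ j)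

  -- On generating functions, a factor x for the indices below `i`. The recursions of `refined` and
  -- of `power` are both written with it, so that they can be compared term by term.
  bump : ∀ {m n} → Fin n → (Fin m → ℕ → ℕ) → Fin m → ℕ → ℕ
  bump i f i′ = if i′ ≺ i then shift (f i′) else f i′

  -- Removing the first letter i of a permutation loses a descent exactly when
  -- the next letter is smaller than i.
  refined-suc : ∀ m (i : Fin (suc (suc m))) j → refined (suc m) i j ≡ sum (λ i′ → bump i (refined m) i′ j)
  refined-suc m i j = begin
    count (descents ∘ prepend i) (permutations (suc m)) j
      ≡⟨ cong (λ σs → count (descents ∘ prepend i) σs j) (permutations-suc m) ⟩
    count (descents ∘ prepend i) (cartesianProductWith prepend (List.allFin (suc m)) (permutations m)) j
      ≡⟨ length-filter-cartesianProductWith (λ σ → descents (prepend i σ) ℕ.≟ j) prepend (λ i′ → i′) (permutations m) ⟩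
    sum (λ i′ → count (λ σ → descents (prepend i (prepend i′ σ))) (permutations m) j)
      ≡⟨ sum-cong-≗ (λ i′ → trans (count-cong (first-descent i′) (permutations m) j) (term i′ (i′ ≺ i))) ⟩
    sum (λ i′ → bump i (refined m) i′ j) ∎
    where
    open ≡-Reasoning
    first-descent : ∀ (i′ : Fin (suc m)) σ →
      descents (prepend i (prepend i′ σ)) ≡ (if i′ ≺ i then 1 else 0) + descents (prepend i′ σ)
    first-descent i′ σ = cong₂ (λ b d → (if b then 1 else 0) + d)
      (does-punchIn-< i i′) (descents-punchIn i (prepend i′ σ))
    term : ∀ i′ b → count (λ σ → (if b then 1 else 0) + descents (prepend i′ σ)) (permutations m) j
      ≡ (if b then shift (refined m i′) else refined m i′) j
    term i′ true  = count-suc (descents ∘ prepend i′) (permutations m) j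
    term i′ false = refl

  -- kⁱ (k + 1)ᵐ⁻ⁱ
  power : ∀ m → Fin (suc m) → ℕ → ℕ
  power m       Fin.zero    k = suc k ^ m
  power (suc m) (Fin.suc i) k = k * power m i k

  -- Geometric sums in k and k + 1, whose difference is 1.
  sum-below : ∀ m (i : Fin (suc (suc m))) k →
    power (suc m) i k + sum (λ i′ → if i′ ≺ i then power m i′ k else 0) ≡ suc k ^ suc m
  sum-below m Fin.zero k = trans (cong (suc k ^ suc m +_) (zeros (suc m))) (ℕ.+-identityʳ _)
    where
    zeros : ∀ n → sum {n} (λ _ → 0) ≡ 0
    zeros zero    = refl
    zeros (suc n) = zeros n
  sum-below zero (Fin.suc Fin.zero) k = solve 1 (λ k → k :* con 1 :+ con 1 := (con 1 :+ k) :* con 1) refl k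
  sum-below (suc m) (Fin.suc i) k = begin
    k * power (suc m) i k + (suc k ^ suc m + sum (λ i′ → if i′ ≺ i then k * power m i′ k else 0))
      ≡⟨ cong (λ s → k * power (suc m) i k + (suc k ^ suc m + s)) factor ⟩
    k * power (suc m) i k + (suc k ^ suc m + k * below)
      ≡⟨ solve 4 (λ k p s b → k :* p :+ (s :+ k :* b) := s :+ k :* (p :+ b)) refl k (power (suc m) i k) (suc k ^ suc m) below ⟩
    suc k ^ suc m + k * (power (suc m) i k + below)
      ≡⟨ cong (λ s → suc k ^ suc m + k * s) (sum-below m i k) ⟩
    suc k * suc k ^ suc m ∎
    where
    open ≡-Reasoning
    below = sum (λ i′ → if i′ ≺ i then power m i′ k else 0)
    term : ∀ b x → (if b then k * x else 0) ≡ k * (if b then x else 0)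
    term true  x = refl
    term false x = sym (ℕ.*-zeroʳ k)
    factor : sum (λ i′ → if i′ ≺ i then k * power m i′ k else 0) ≡ k * below
    factor = trans (sum-cong-≗ (λ i′ → term (i′ ≺ i) (power m i′ k)))
      (sym (*-distribˡ-sum k (λ i′ → if i′ ≺ i then power m i′ k else 0)))

  sum-above : ∀ m (i : Fin (suc (suc m))) k →
    power (suc m) i k ≡ k ^ suc m + sum (λ i′ → if i′ ≺ i then 0 else power m i′ k)
  sum-above zero    Fin.zero           k = solve 1 (λ k → (con 1 :+ k) :* con 1 := k :* con 1 :+ con 1) refl k
  sum-above zero    (Fin.suc Fin.zero) k = sym (ℕ.+-identityʳ _)
  sum-above (suc m) Fin.zero           k = begin
    suc k * suc k ^ suc m
      ≡⟨ cong (λ s → suc k ^ suc m + k * s) (sum-above m Fin.zero k) ⟩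
    suc k ^ suc m + k * (k ^ suc m + above)
      ≡⟨ solve 4 (λ k q s b → s :+ k :* (q :+ b) := k :* q :+ (s :+ k :* b)) refl k (k ^ suc m) (suc k ^ suc m) above ⟩
    k * k ^ suc m + (suc k ^ suc m + k * above)
      ≡⟨ cong (λ s → k * k ^ suc m + (suc k ^ suc m + s)) (*-distribˡ-sum k (λ i′ → power m i′ k)) ⟩
    k * k ^ suc m + (suc k ^ suc m + sum (λ i′ → k * power m i′ k)) ∎
    where
    open ≡-Reasoning
    above = sum (λ i′ → power m i′ k)
  sum-above (suc m) (Fin.suc i)        k = begin
    k * power (suc m) i k
      ≡⟨ cong (k *_) (sum-above m i k) ⟩
    k * (k ^ suc m + above)
      ≡⟨ ℕ.*-distribˡ-+ k (k ^ suc m) above ⟩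
    k * k ^ suc m + k * above
      ≡⟨ cong (k * k ^ suc m +_) factor ⟨
    k * k ^ suc m + sum (λ i′ → if i′ ≺ i then 0 else k * power m i′ k) ∎
    where
    open ≡-Reasoning
    above = sum (λ i′ → if i′ ≺ i then 0 else power m i′ k)
    term : ∀ b x → (if b then 0 else k * x) ≡ k * (if b then 0 else x)
    term true  x = sym (ℕ.*-zeroʳ k)
    term false x = refl
    factor : sum (λ i′ → if i′ ≺ i then 0 else k * power m i′ k) ≡ k * above
    factor = trans (sum-cong-≗ (λ i′ → term (i′ ≺ i) (power m i′ k)))
      (sym (*-distribˡ-sum k (λ i′ → if i′ ≺ i then 0 else power m i′ k)))

  power-zero : ∀ m (i : Fin (suc (suc m))) →
    power (suc m) i 0 ≡ sum (λ i′ → bump i (power m) i′ 0)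
  -- At k = 0 the summand `k ^ suc m` of `sum-above` computes to 0.
  power-zero m i = trans (sum-above m i 0) (sum-cong-≗ (λ i′ → term (i′ ≺ i) (power m i′)))
    where
    term : ∀ b f → (if b then 0 else f 0) ≡ (if b then shift f else f) 0
    term true  f = refl
    term false f = refl

  -- The increment is cut at `suc k ^ suc m`. The part above is the sum over the indices from `i`
  -- on, evaluated at `suc k` (`sum-above`); the part below is the sum over the indices less than
  -- `i`, evaluated at `k` and hence shifted (`sum-below`). With `power-zero` this is the recursion
  -- of `refined-suc`, except for a factor 1 - x on the left.
  power-suc : ∀ m (i : Fin (suc (suc m))) k →
    power (suc m) i (suc k) ≡
    power (suc m) i k + sum (λ i′ → bump i (power m) i′ (suc k))
  power-suc m i k = begin
    power (suc m) i (suc k)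
      ≡⟨ sum-above m i (suc k) ⟩
    suc k ^ suc m + above
      ≡⟨ cong (_+ above) (sum-below m i k) ⟨
    power (suc m) i k + below + above
      ≡⟨ ℕ.+-assoc (power (suc m) i k) below above ⟩
    power (suc m) i k + (below + above)
      ≡⟨ cong (power (suc m) i k +_) (∑-distrib-+ (λ i′ → if i′ ≺ i then power m i′ k else 0)
           (λ i′ → if i′ ≺ i then 0 else power m i′ (suc k))) ⟨
    power (suc m) i k + sum (λ i′ → (if i′ ≺ i then power m i′ k else 0) + (if i′ ≺ i then 0 else power m i′ (suc k)))
      ≡⟨ cong (power (suc m) i k +_) (sum-cong-≗ (λ i′ → term (i′ ≺ i) (power m i′))) ⟩
    power (suc m) i k + sum (λ i′ → bump i (power m) i′ (suc k)) ∎
    where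
    open ≡-Reasoning
    below = sum (λ i′ → if i′ ≺ i then power m i′ k else 0)
    above = sum (λ i′ → if i′ ≺ i then 0 else power m i′ (suc k))
    term : ∀ b f → (if b then f k else 0) + (if b then 0 else f (suc k)) ≡ (if b then shift f else f) (suc k)
    term true  f = ℕ.+-identityʳ (f k)
    term false f = refl

open EulerianNumbers using (power; refined; refined-suc; A≡refined; shift; bump; _≺_; power-zero; power-suc)

^-distribʳ-* : ∀ n a b → (a ℕ.* b) ℕ.^ n ≡ a ℕ.^ n ℕ.* b ℕ.^ n
^-distribʳ-* zero    a b = ≡.refl
^-distribʳ-* (suc n) a b = ≡.trans (≡.cong (a ℕ.* b ℕ.*_) (^-distribʳ-* n a b))
  (ℕ.[m*n]*[o*p]≡[m*o]*[n*p] a b (a ℕ.^ n) (b ℕ.^ n))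

ℕsum : ∀ {n} → Vector ℕ n → ℕ
ℕsum = Sums.sum ℕ.+-*-semiring

-- Algebra in a Heyting field.

module FieldProperties {c ℓ₁ ℓ₂} (F : HeytingField c ℓ₁ ℓ₂) where
  open Field F
  open CommutativeRing commutativeRing using (ring; +-abelianGroup; +-commutativeMonoid; *-commutativeMonoid)
  open RingProperties ring public using (-1*x≈-x; x[y-z]≈xy-xz; [y-z]x≈yx-zx; -‿distribʳ-*; -‿distribˡ-*; -‿involutive)
  open HeytingProperties heytingCommutativeRing public using (x-0≈x; invertibleˡ⇒#)
  open AbelianGroupProperties +-abelianGroup public using (⁻¹-∙-comm; xyx⁻¹≈y)
  open CommutativeSemigroupProperties (CommutativeMonoid.commutativeSemigroup +-commutativeMonoid) using ()
    renaming (interchange to +-interchange)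
  open CommutativeSemigroupProperties (CommutativeMonoid.commutativeSemigroup *-commutativeMonoid) public using ()
    renaming (x∙yz≈y∙xz to x*yz≈y*xz; xy∙z≈xz∙y to xy*z≈xz*y)
  open Sums semiring public using (sum-cong-≋; sum-replicate)
  open Multiples semiring public using (×-homo-+; ×1-homo-*; ×-assoc-*; ×-congʳ)
  open ≈-Reasoning setoid

  fromℕ-+ : ∀ m n → fromℕ (m ℕ.+ n) ≈ fromℕ m + fromℕ n
  fromℕ-+ = ×-homo-+ 1#

  fromℕ-* : ∀ m n → fromℕ (m ℕ.* n) ≈ fromℕ m * fromℕ n
  fromℕ-* = ×1-homo-*

  fromℕ-cong : ∀ {m n} → m ≡ n → fromℕ m ≈ fromℕ n
  fromℕ-cong ≡.refl = refl

  fromℕ-sum : ∀ {n} (t : Vector ℕ n) → fromℕ (ℕsum t) ≈ sum (fromℕ ∘ t)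
  fromℕ-sum {zero}  t = refl
  fromℕ-sum {suc n} t = trans (fromℕ-+ (t Fin.zero) _) (+-congˡ (fromℕ-sum (tail t)))

  [x+y]-[z+w] : ∀ x y z w → (x + y) - (z + w) ≈ (x - z) + (y - w)
  [x+y]-[z+w] x y z w = begin
    (x + y) - (z + w)      ≈⟨ +-congˡ (⁻¹-∙-comm z w) ⟨
    (x + y) + (- z + - w)  ≈⟨ +-interchange x y (- z) (- w) ⟩
    (x - z) + (y - w)      ∎

  x+[y-x]≈y : ∀ x y → x + (y - x) ≈ y
  x+[y-x]≈y x y = trans (sym (+-assoc x y (- x))) (xyx⁻¹≈y x y)

  x-y≈z⇒x≈y+z : ∀ {x y z} → x - y ≈ z → x ≈ y + z
  x-y≈z⇒x≈y+z {x} {y} x-y≈z = trans (sym (x+[y-x]≈y y x)) (+-congˡ x-y≈z)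

  x≈y⇒x-y≈0 : ∀ {x y} → x ≈ y → x - y ≈ 0#
  x≈y⇒x-y≈0 {x} {y} x≈y = trans (+-congʳ x≈y) (-‿inverseʳ y)

  infix 9 _⁻¹[_]
  _⁻¹[_] : ∀ y → y # 0# → Carrier
  y ⁻¹[ y#0 ] = proj₁ (#⇒invertible y#0)

  *-inverseʳ : ∀ {y} (y#0 : y # 0#) → y * y ⁻¹[ y#0 ] ≈ 1#
  -- `#⇒invertible` speaks of the difference `y - 0#` rather than of `y`.
  *-inverseʳ {y} y#0 = trans (*-congʳ (sym (x-0≈x y))) (proj₂ (proj₂ (#⇒invertible y#0)))

  *-inverse-unique : ∀ {x y z} → x * y ≈ 1# → x * z ≈ 1# → y ≈ z
  *-inverse-unique {x} {y} {z} xy≈1 xz≈1 = begin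
    y            ≈⟨ *-identityʳ y ⟨
    y * 1#       ≈⟨ *-congˡ xz≈1 ⟨
    y * (x * z)  ≈⟨ x*yz≈y*xz y x z ⟩
    x * (y * z)  ≈⟨ *-assoc x y z ⟨
    x * y * z    ≈⟨ *-congʳ xy≈1 ⟩
    1# * z       ≈⟨ *-identityˡ z ⟩
    z            ∎

-- Linear operators on power series and Worpitzky's identity.

module SeriesProperties {c ℓ₁ ℓ₂ ℓ₃ c′ ℓ₁′ ℓ₂′}
  {R : ArchimedeanOrderedField c ℓ₁ ℓ₂ ℓ₃} (K : ValuedField R c′ ℓ₁′ ℓ₂′) where
  open Analysis K
  open FieldProperties heytingField
  open ≈-Reasoning setoid

  infix 4 _≐_
  _≐_ : Series → Series → Set ℓ₁′
  f ≐ g = ∀ k → f k ≈ g k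

  -- Scalars act on the right, as the inverse does in `_/_[_]`, so that `*-homo` covers division by
  -- a constant.
  record IsLinear (T : Series → Series) : Set (c′ ⊔ ℓ₁′) where
    field
      cong   : ∀ {f g} → f ≐ g → T f ≐ T g
      +-homo : ∀ f g → T (λ k → f k + g k) ≐ (λ k → T f k + T g k)
      *-homo : ∀ f x → T (λ k → f k * x) ≐ (λ k → T f k * x)

    sum-homo : ∀ {n} (F : Vector Series n) → T (λ k → sum (λ i → F i k)) ≐ (λ k → sum (λ i → T (F i) k))
    sum-homo {zero}  F k = begin
      T (λ _ → 0#) k       ≈⟨ cong (λ _ → zeroʳ 0#) k ⟨
      T (λ _ → 0# * 0#) k  ≈⟨ *-homo _ _ k ⟩
      T (λ _ → 0#) k * 0#  ≈⟨ zeroʳ _ ⟩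
      0#                   ∎
    sum-homo {suc n} F k = trans (+-homo (F Fin.zero) _ k) (+-congˡ (sum-homo (tail F) k))

    minus-homo : ∀ f g → T (λ k → f k - g k) ≐ (λ k → T f k - T g k)
    minus-homo f g k = begin
      T (λ k → f k - g k) k             ≈⟨ cong (λ k → +-congˡ (negate (g k))) k ⟨
      T (λ k → f k + g k * - 1#) k      ≈⟨ +-homo f _ k ⟩
      T f k + T (λ k → g k * - 1#) k    ≈⟨ +-congˡ (*-homo g (- 1#) k) ⟩
      T f k + T g k * - 1#              ≈⟨ +-congˡ (negate (T g k)) ⟩
      T f k - T g k                     ∎
      where
      negate : ∀ x → x * - 1# ≈ - x
      negate x = trans (*-comm x (- 1#)) (-1*x≈-x x)

  module Lin = IsLinear

  id-isLinear : IsLinear id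
  id-isLinear = record { cong = id ; +-homo = λ _ _ _ → refl ; *-homo = λ _ _ _ → refl }

  ∘-isLinear : ∀ {S T} → IsLinear S → IsLinear T → IsLinear (S ∘ T)
  ∘-isLinear S-lin T-lin = record
    { cong   = S.cong ∘ T.cong
    ; +-homo = λ f g k → trans (S.cong (T.+-homo f g) k) (S.+-homo _ _ k)
    ; *-homo = λ f x k → trans (S.cong (T.*-homo f x) k) (S.*-homo _ x k)
    }
    where
    module S = IsLinear S-lin
    module T = IsLinear T-lin

  [1-x]-isLinear : IsLinear [1-x]·_
  [1-x]-isLinear = record
    { cong   = λ { f≐g zero → +-congʳ (f≐g zero) ; f≐g (suc k) → +-cong (f≐g (suc k)) (-‿cong (f≐g k)) }
    ; +-homo = λ { f g zero    → trans (+-congˡ (-‿cong (sym (+-identityʳ 0#)))) ([x+y]-[z+w] (f 0) (g 0) 0# 0#)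
                 ; f g (suc k) → [x+y]-[z+w] (f (suc k)) (g (suc k)) (f k) (g k) }
    ; *-homo = λ { f x zero    → trans (+-congˡ (-‿cong (sym (zeroˡ x)))) (sym ([y-z]x≈yx-zx x (f 0) 0#))
                 ; f x (suc k) → sym ([y-z]x≈yx-zx x (f (suc k)) (f k)) }
    }

  [1-x]^-isLinear : ∀ m → IsLinear ([1-x]^ m ·_)
  [1-x]^-isLinear zero    = id-isLinear
  [1-x]^-isLinear (suc m) = ∘-isLinear ([1-x]^-isLinear m) [1-x]-isLinear

  [1-x]^-x· : ∀ m f → [1-x]^ m · x· f ≐ x· [1-x]^ m · f
  [1-x]^-x· zero    f k = refl
  [1-x]^-x· (suc m) f k = trans (Lin.cong ([1-x]^-isLinear m) step k) ([1-x]^-x· m ([1-x]· f) k)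
    where
    step : [1-x]· x· f ≐ x· [1-x]· f
    step zero          = -‿inverseʳ 0#
    step (suc zero)    = refl
    step (suc (suc k)) = refl

  -- The definition applies the additional factor first; reading off partial sums of `h` requires it
  -- last.
  [1-x]^-suc : ∀ m f k → ([1-x]^ suc m · f) k ≡ ([1-x]· [1-x]^ m · f) k
  [1-x]^-suc zero    f k = ≡.refl
  [1-x]^-suc (suc m) f k = [1-x]^-suc m ([1-x]· f) k

  -- Induction on `m`. One factor 1 - x turns the series of `power (suc m) i` into a sum of bumped
  -- series of `power m`. The remaining factors commute with multiplication by x, so the induction
  -- hypothesis turns this into the bumped sum of `refined m`, which `refined-suc` identifies.
  [1-x]^-power : ∀ m i → [1-x]^ suc m · (fromℕ ∘ power m i) ≐ fromℕ ∘ refined m i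
  -- A single letter: 1 - x times the geometric series is 1.
  [1-x]^-power zero    Fin.zero zero    = x-0≈x _
  [1-x]^-power zero    Fin.zero (suc k) = -‿inverseʳ _
  [1-x]^-power (suc m) i        k       = begin
    ([1-x]^ suc (suc m) · (fromℕ ∘ power (suc m) i)) k
      ≈⟨ Lin.cong ([1-x]^-isLinear (suc m)) step k ⟩
    ([1-x]^ suc m · (λ k → sum (λ i′ → fromℕ (bump i (power m) i′ k)))) k
      ≈⟨ Lin.sum-homo ([1-x]^-isLinear (suc m)) (λ i′ → fromℕ ∘ bump i (power m) i′) k ⟩
    sum (λ i′ → ([1-x]^ suc m · (fromℕ ∘ bump i (power m) i′)) k)
      ≈⟨ sum-cong-≋ (λ i′ → term (i′ ≺ i) i′) ⟩
    sum (λ i′ → fromℕ (bump i (refined m) i′ k))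
      ≈⟨ fromℕ-sum (λ i′ → bump i (refined m) i′ k) ⟨
    fromℕ (ℕsum (λ i′ → bump i (refined m) i′ k))
      ≈⟨ fromℕ-cong (refined-suc m i k) ⟨
    fromℕ (refined (suc m) i k) ∎
    where
    step : [1-x]· (fromℕ ∘ power (suc m) i) ≐ (λ k → sum (λ i′ → fromℕ (bump i (power m) i′ k)))
    step zero    = begin
      fromℕ (power (suc m) i 0) - 0#  ≈⟨ x-0≈x _ ⟩
      fromℕ (power (suc m) i 0)       ≈⟨ fromℕ-cong (power-zero m i) ⟩
      fromℕ (ℕsum (λ i′ → bump i (power m) i′ 0)) ≈⟨ fromℕ-sum (λ i′ → bump i (power m) i′ 0) ⟩
      sum (λ i′ → fromℕ (bump i (power m) i′ 0)) ∎
    step (suc k) = begin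
      fromℕ (power (suc m) i (suc k)) - fromℕ (power (suc m) i k)
        ≈⟨ +-congʳ (trans (fromℕ-cong (power-suc m i k)) (fromℕ-+ (power (suc m) i k) _)) ⟩
      fromℕ (power (suc m) i k) + fromℕ (ℕsum (λ i′ → bump i (power m) i′ (suc k))) - fromℕ (power (suc m) i k)
        ≈⟨ xyx⁻¹≈y _ _ ⟩
      fromℕ (ℕsum (λ i′ → bump i (power m) i′ (suc k)))
        ≈⟨ fromℕ-sum (λ i′ → bump i (power m) i′ (suc k)) ⟩
      sum (λ i′ → fromℕ (bump i (power m) i′ (suc k))) ∎
    fromℕ-shift : ∀ f → fromℕ ∘ shift f ≐ x· (fromℕ ∘ f)
    fromℕ-shift f zero    = refl
    fromℕ-shift f (suc k) = refl
    term : ∀ b i′ → ([1-x]^ suc m · (fromℕ ∘ (if b then shift (power m i′) else power m i′))) k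
      ≈ fromℕ ((if b then shift (refined m i′) else refined m i′) k)
    term false i′ = [1-x]^-power m i′ k
    term true  i′ = begin
      ([1-x]^ suc m · (fromℕ ∘ shift (power m i′))) k
        ≈⟨ Lin.cong ([1-x]^-isLinear (suc m)) (fromℕ-shift (power m i′)) k ⟩
      ([1-x]^ suc m · x· (fromℕ ∘ power m i′)) k
        ≈⟨ [1-x]^-x· (suc m) (fromℕ ∘ power m i′) k ⟩
      (x· [1-x]^ suc m · (fromℕ ∘ power m i′)) k
        ≈⟨ x·-cong ([1-x]^-power m i′) k ⟩
      (x· (fromℕ ∘ refined m i′)) k
        ≈⟨ fromℕ-shift (refined m i′) k ⟨
      fromℕ (shift (refined m i′) k) ∎
      where
      x·-cong : ∀ {f g} → f ≐ g → x· f ≐ x· g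
      x·-cong f≐g zero    = refl
      x·-cong f≐g (suc k) = f≐g k

  -- For n ≥ 1 the term at k = 0 vanishes, so the series is x times that of (k + 1)ⁿ, which is
  -- `power n` at index zero. This x is the one in the exponent j + 1 of the Eulerian polynomial.
  worpitzky : ∀ n → .{{NonZero n}} → [1-x]^ suc n · (λ k → fromℕ (k ℕ.^ n)) ≐ fromℕ ∘ eulerianCoeff n
  worpitzky n@(suc _) k = trans (Lin.cong ([1-x]^-isLinear (suc n)) shifted k)
    (trans ([1-x]^-x· (suc n) (λ k → fromℕ (suc k ℕ.^ n)) k) (coefficient k))
    where
    shifted : (λ k → fromℕ (k ℕ.^ n)) ≐ x· (λ k → fromℕ (suc k ℕ.^ n))
    shifted zero    = refl
    shifted (suc k) = refl
    coefficient : x· [1-x]^ suc n · (λ k → fromℕ (suc k ℕ.^ n)) ≐ fromℕ ∘ eulerianCoeff n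
    coefficient zero    = refl
    coefficient (suc j) = trans ([1-x]^-power n Fin.zero j) (fromℕ-cong (≡.sym (A≡refined n j)))

  -- Forward differences.

  Δ : Series → Series
  Δ f k = f (suc k) - f k

  Δ^ : ℕ → Series → Series
  Δ^ zero    f = f
  Δ^ (suc m) f = Δ^ m (Δ f)

  Δ-isLinear : IsLinear Δ
  Δ-isLinear = record
    { cong   = λ f≐g k → Lin.cong [1-x]-isLinear f≐g (suc k)
    ; +-homo = λ f g k → Lin.+-homo [1-x]-isLinear f g (suc k)
    ; *-homo = λ f x k → Lin.*-homo [1-x]-isLinear f x (suc k)
    }

  Δ^-isLinear : ∀ m → IsLinear (Δ^ m)
  Δ^-isLinear zero    = id-isLinear
  Δ^-isLinear (suc m) = ∘-isLinear (Δ^-isLinear m) Δ-isLinear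

  Δ^-tail : ∀ m f k → Δ^ m f (suc k) ≡ Δ^ m (f ∘ suc) k
  Δ^-tail zero    f k = ≡.refl
  Δ^-tail (suc m) f k = Δ^-tail m (Δ f) k

  Δ^-suc : ∀ m f k → Δ^ (suc m) f k ≡ Δ (Δ^ m f) k
  Δ^-suc zero    f k = ≡.refl
  Δ^-suc (suc m) f k = Δ^-suc m (Δ f) k

  -- `([1-x]· f) (suc k)` is `Δ f k` by definition, so m factors move the index by m. At smaller
  -- indices the boundary value 0 of `x·_` enters.
  [1-x]^≡Δ^ : ∀ m f k → ([1-x]^ m · f) (m ℕ.+ k) ≡ Δ^ m f k
  [1-x]^≡Δ^ zero    f k = ≡.refl
  [1-x]^≡Δ^ (suc m) f k = ≡.trans (≡.cong ([1-x]^ m · [1-x]· f) (≡.sym (ℕ.+-suc m k)))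
    (≡.trans ([1-x]^≡Δ^ m ([1-x]· f) (suc k)) (Δ^-tail m ([1-x]· f) k))

  constant⇒Δ≈0 : ∀ m f {x} → (∀ k → Δ^ m f k ≈ x) → ∀ k → Δ^ (suc m) f k ≈ 0#
  constant⇒Δ≈0 m f const k = trans (reflexive (Δ^-suc m f k)) (x≈y⇒x-y≈0 (trans (const (suc k)) (sym (const k))))

  -- The Leibniz rule for a product with the sequence k: its second difference is 0, so only two
  -- terms remain.
  Δ^-fromℕ* : ∀ m f k →
    Δ^ (suc m) (λ k → fromℕ k * f k) k ≈ fromℕ k * Δ^ (suc m) f k + fromℕ (suc m) * Δ^ m f (suc k)
  Δ^-fromℕ* zero f k = begin
    (1# + fromℕ k) * f (suc k) - fromℕ k * f k
      ≈⟨ +-congʳ (distribʳ _ _ _) ⟩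
    1# * f (suc k) + fromℕ k * f (suc k) - fromℕ k * f k
      ≈⟨ +-assoc _ _ _ ⟩
    1# * f (suc k) + (fromℕ k * f (suc k) - fromℕ k * f k)
      ≈⟨ +-comm _ _ ⟩
    (fromℕ k * f (suc k) - fromℕ k * f k) + 1# * f (suc k)
      ≈⟨ +-cong (x[y-z]≈xy-xz _ _ _) (*-congʳ (+-identityʳ 1#)) ⟨
    fromℕ k * Δ f k + fromℕ 1 * f (suc k) ∎
  Δ^-fromℕ* (suc m) f k = begin
    Δ^ (suc m) (Δ (λ k → fromℕ k * f k)) k
      ≈⟨ Lin.cong (Δ^-isLinear (suc m)) (λ k →
           trans (Δ^-fromℕ* zero f k) (+-congˡ (trans (*-congʳ (+-identityʳ 1#)) (*-identityˡ _)))) k ⟩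
    Δ^ (suc m) (λ k → fromℕ k * Δ f k + f (suc k)) k
      ≈⟨ Lin.+-homo (Δ^-isLinear (suc m)) (λ k → fromℕ k * Δ f k) (f ∘ suc) k ⟩
    Δ^ (suc m) (λ k → fromℕ k * Δ f k) k + Δ^ (suc m) (f ∘ suc) k
      ≈⟨ +-cong (Δ^-fromℕ* m (Δ f) k) (trans (reflexive (≡.sym (Δ^-tail (suc m) f k))) (sym (*-identityˡ _))) ⟩
    fromℕ k * Δ^ (suc m) (Δ f) k + fromℕ (suc m) * Δ^ (suc m) f (suc k) + 1# * Δ^ (suc m) f (suc k)
      ≈⟨ +-assoc _ _ _ ⟩
    fromℕ k * Δ^ (suc (suc m)) f k + (fromℕ (suc m) * Δ^ (suc m) f (suc k) + 1# * Δ^ (suc m) f (suc k))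
      ≈⟨ +-congˡ (trans (+-comm _ _) (sym (distribʳ _ _ _))) ⟩
    fromℕ k * Δ^ (suc (suc m)) f k + fromℕ (suc (suc m)) * Δ^ (suc m) f (suc k) ∎

  -- Induction by the Leibniz rule. The first term contains the difference of the constant n! and
  -- vanishes; the second contributes the factor n + 1.
  Δ^-power : ∀ n k → Δ^ n (λ k → fromℕ (k ℕ.^ n)) k ≈ fromℕ (n !)
  Δ^-power zero    k = refl
  Δ^-power (suc n) k = begin
    Δ^ (suc n) (λ k → fromℕ (k ℕ.* k ℕ.^ n)) k
      ≈⟨ Lin.cong (Δ^-isLinear (suc n)) (λ k → fromℕ-* k (k ℕ.^ n)) k ⟩
    Δ^ (suc n) (λ k → fromℕ k * fromℕ (k ℕ.^ n)) k
      ≈⟨ Δ^-fromℕ* n (λ k → fromℕ (k ℕ.^ n)) k ⟩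
    fromℕ k * Δ^ (suc n) (λ k → fromℕ (k ℕ.^ n)) k + fromℕ (suc n) * Δ^ n (λ k → fromℕ (k ℕ.^ n)) (suc k)
      ≈⟨ +-cong (*-congˡ (constant⇒Δ≈0 n _ (Δ^-power n) k)) (*-congˡ (Δ^-power n (suc k))) ⟩
    fromℕ k * 0# + fromℕ (suc n) * fromℕ (n !)
      ≈⟨ +-cong (zeroʳ _) (sym (fromℕ-* (suc n) (n !))) ⟩
    0# + fromℕ (suc n ℕ.* n !)
      ≈⟨ +-identityˡ _ ⟩
    fromℕ (suc n !) ∎

  telescope : ∀ f b m → f (b ℕ.+ m) - f m ≈ sum {b} (λ i → Δ f (toℕ i ℕ.+ m))
  telescope f zero    m = -‿inverseʳ _
  telescope f (suc b) m = begin
    f (suc b ℕ.+ m) - f m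
      ≈⟨ +-congʳ (x+[y-x]≈y (f (suc m)) _) ⟨
    f (suc m) + (f (suc b ℕ.+ m) - f (suc m)) - f m
      ≈⟨ trans (+-congʳ (+-comm _ _)) (trans (+-assoc _ _ _) (+-comm _ _)) ⟩
    Δ f m + (f (suc b ℕ.+ m) - f (suc m))
      ≡⟨ ≡.cong (λ k → Δ f m + (f k - f (suc m))) (≡.sym (ℕ.+-suc b m)) ⟩
    Δ f m + (f (b ℕ.+ suc m) - f (suc m))
      ≈⟨ +-congˡ (telescope f b (suc m)) ⟩
    Δ f m + sum {b} (λ i → Δ f (toℕ i ℕ.+ suc m))
      ≈⟨ +-congˡ (sum-cong-≋ {b} (λ i → reflexive (≡.cong (Δ f) (ℕ.+-suc (toℕ i) m)))) ⟩
    Δ f m + sum {b} (λ i → Δ f (suc (toℕ i) ℕ.+ m)) ∎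

  -- One difference of the subsample telescopes into b differences of `f`, at the offsets r, ..., r
  -- + b - 1. Each is a subsample of `Δ f`, to which the induction applies; hence one factor b per
  -- difference. The offset `r` is there for this induction.
  Δ^-subsample : ∀ d f {x} → (∀ k → Δ^ d f k ≈ x) → ∀ b r k →
    Δ^ d (λ k → f (b ℕ.* k ℕ.+ r)) k ≈ fromℕ (b ℕ.^ d) * x
  Δ^-subsample zero    f {x} const b r k = trans (const _) (sym (trans (*-congʳ (+-identityʳ 1#)) (*-identityˡ x)))
  Δ^-subsample (suc d) f {x} const b r k = begin
    Δ^ d (Δ (λ k → f (b ℕ.* k ℕ.+ r))) k
      ≈⟨ Lin.cong (Δ^-isLinear d) step k ⟩
    Δ^ d (λ k → sum {b} (λ i → Δ f (b ℕ.* k ℕ.+ (toℕ i ℕ.+ r)))) k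
      ≈⟨ Lin.sum-homo (Δ^-isLinear d) (λ (i : Fin b) k → Δ f (b ℕ.* k ℕ.+ (toℕ i ℕ.+ r))) k ⟩
    sum {b} (λ i → Δ^ d (λ k → Δ f (b ℕ.* k ℕ.+ (toℕ i ℕ.+ r))) k)
      ≈⟨ sum-cong-≋ {b} (λ i → Δ^-subsample d (Δ f) const b (toℕ i ℕ.+ r) k) ⟩
    sum {b} (λ i → fromℕ (b ℕ.^ d) * x)
      ≈⟨ sum-replicate b ⟩
    b · (fromℕ (b ℕ.^ d) * x)
      ≈⟨ ×-congʳ b (*-identityˡ _) ⟨
    b · (1# * (fromℕ (b ℕ.^ d) * x))
      ≈⟨ ×-assoc-* b 1# _ ⟨
    fromℕ b * (fromℕ (b ℕ.^ d) * x)
      ≈⟨ *-assoc _ _ _ ⟨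
    fromℕ b * fromℕ (b ℕ.^ d) * x
      ≈⟨ *-congʳ (fromℕ-* b (b ℕ.^ d)) ⟨
    fromℕ (b ℕ.^ suc d) * x ∎
    where
    step : Δ (λ k → f (b ℕ.* k ℕ.+ r)) ≐ (λ k → sum {b} (λ i → Δ f (b ℕ.* k ℕ.+ (toℕ i ℕ.+ r))))
    step k = begin
      f (b ℕ.* suc k ℕ.+ r) - f (b ℕ.* k ℕ.+ r)
        ≡⟨ ≡.cong (λ m → f m - f (b ℕ.* k ℕ.+ r))
             (solve 3 (λ b k r → b :* (con 1 :+ k) :+ r := b :+ (b :* k :+ r)) ≡.refl b k r) ⟩
      f (b ℕ.+ (b ℕ.* k ℕ.+ r)) - f (b ℕ.* k ℕ.+ r)
        ≈⟨ telescope f b (b ℕ.* k ℕ.+ r) ⟩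
      sum {b} (λ i → Δ f (toℕ i ℕ.+ (b ℕ.* k ℕ.+ r)))
        ≈⟨ sum-cong-≋ {b} (λ i → reflexive (≡.cong (Δ f)
             (solve 3 (λ i m r → i :+ (m :+ r) := m :+ (i :+ r)) ≡.refl (toℕ i) (b ℕ.* k) r))) ⟩
      sum {b} (λ i → Δ f (b ℕ.* k ℕ.+ (toℕ i ℕ.+ r))) ∎

  -- `coeff h` is 0 from index m on, so `s` has stopped changing by then. The initial value `x` is
  -- arbitrary in order that the induction may pass to `tail h`.
  sum-of-increments : ∀ {m} (h : Vector Carrier m) s {x} → s 0 ≈ x → (∀ k → Δ s k ≈ coeff h k) →
    ∀ k → s (m ℕ.+ k) ≈ x + sum h
  sum-of-increments {zero} h s s₀ Δs k = trans (go k) (sym (+-identityʳ _))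
    where
    go : ∀ k → s k ≈ _
    go zero    = s₀
    go (suc k) = trans (x-y≈z⇒x≈y+z (Δs k)) (trans (+-identityʳ _) (go k))
  sum-of-increments {suc m} h s s₀ Δs k = trans
    (sum-of-increments (tail h) (s ∘ suc) (trans (x-y≈z⇒x≈y+z (Δs 0)) (+-congʳ s₀)) (Δs ∘ suc) k)
    (+-assoc _ _ _)

  eval-1 : ∀ {d} (h : Polynomial d) → eval h 1# ≈ sum h
  eval-1 {d} h = sum-cong-≋ {suc d} (λ i → trans (*-congˡ (one^ (toℕ i))) (*-identityʳ (h i)))
    where
    one^ : ∀ m → 1# ^ m ≈ 1#
    one^ zero    = refl
    one^ (suc m) = trans (*-identityˡ _) (one^ m)

  coeff-toℕ : ∀ {m} (h : Vector Carrier m) i → coeff h (toℕ i) ≡ h i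
  coeff-toℕ h Fin.zero    = ≡.refl
  coeff-toℕ h (Fin.suc i) = coeff-toℕ (tail h) i

  truncate : ∀ m (s : Series) → (∀ k → s (m ℕ.+ k) ≈ 0#) → s ≐ coeff {m} (s ∘ toℕ)
  truncate zero    s s≈0 k       = s≈0 k
  truncate (suc m) s s≈0 zero    = refl
  truncate (suc m) s s≈0 (suc k) = truncate m (s ∘ suc) s≈0 k

  -- Series of the form h(x) / (1 - x)ⁿ⁺¹ and their subsamples.

  module _ (n : ℕ) (h : Polynomial (suc n)) (a : Series) (a-series : a IsSeriesOf h /[1-x]^ suc n) where

    -- The coefficients of `[1-x]^ n · a` are the partial sums of `h`, complete from index n + 1 on.
    -- For `Δ^ n a`, whose index is smaller by n, this means from index 1 on; hence `a ∘ suc`.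
    Δ^-tail-a : ∀ k → Δ^ n (a ∘ suc) k ≈ eval h 1#
    Δ^-tail-a k = begin
      Δ^ n (a ∘ suc) k               ≡⟨ Δ^-tail n a k ⟨
      Δ^ n a (suc k)                 ≡⟨ [1-x]^≡Δ^ n a (suc k) ⟨
      ([1-x]^ n · a) (n ℕ.+ suc k)   ≡⟨ ≡.cong ([1-x]^ n · a) (ℕ.+-suc n k) ⟩
      -- The 0 put in front by `x·_` makes the constant coefficient of `h` an increment too, and the
      -- summation starts from 0.
      ([1-x]^ n · a) (suc n ℕ.+ k)   ≈⟨ sum-of-increments h (x· [1-x]^ n · a) refl increments k ⟩
      0# + sum h                     ≈⟨ +-identityˡ (sum h) ⟩
      sum h                          ≈⟨ eval-1 h ⟨
      eval h 1#                      ∎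
      where
      increments : ∀ k → Δ (x· [1-x]^ n · a) k ≈ coeff h k
      increments k = trans (reflexive (≡.sym ([1-x]^-suc n a k))) (a-series k)

    -- Uniqueness is immediate, as `IsSeriesOf` prescribes every coefficient. Existence amounts to
    -- `s` vanishing beyond degree n + 1, which holds because the n-th difference of the subsample
    -- is constant away from index 0.
    subsample-expansion : ∀ b → .{{NonZero b}} →
      ∃! _≋_ λ (g : Polynomial (suc n)) → (λ k → a (b ℕ.* k)) IsSeriesOf g /[1-x]^ suc n
    subsample-expansion b@(suc b′) = s ∘ toℕ , truncate (suc (suc n)) s vanishes ,
      λ {g} s≈g i → trans (s≈g (toℕ i)) (reflexive (coeff-toℕ g i))
      where
      aᵇ : Series
      aᵇ k = a (b ℕ.* k)
      s = [1-x]^ suc n · aᵇ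
      -- Since b (k + 1) = 1 + (b k + (b - 1)), the tail of the subsample is a subsample of
      -- `a ∘ suc` with offset b - 1, where `Δ^-tail-a` applies.
      aᵇ-suc : aᵇ ∘ suc ≐ (λ k → a (suc (b ℕ.* k ℕ.+ b′)))
      aᵇ-suc k = reflexive (≡.cong a (≡.trans (ℕ.*-suc b k) (≡.cong suc (ℕ.+-comm b′ (b ℕ.* k)))))
      vanishes : ∀ k → s (suc (suc n) ℕ.+ k) ≈ 0#
      vanishes k = begin
        s (suc (suc n) ℕ.+ k)        ≡⟨ ≡.cong s (≡.sym (ℕ.+-suc (suc n) k)) ⟩
        s (suc n ℕ.+ suc k)          ≡⟨ [1-x]^≡Δ^ (suc n) aᵇ (suc k) ⟩
        Δ^ (suc n) aᵇ (suc k)        ≡⟨ Δ^-tail (suc n) aᵇ k ⟩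
        Δ^ (suc n) (aᵇ ∘ suc) k      ≈⟨ Lin.cong (Δ^-isLinear (suc n)) aᵇ-suc k ⟩
        Δ^ (suc n) (λ k → a (suc (b ℕ.* k ℕ.+ b′))) k
          ≈⟨ constant⇒Δ≈0 n _ (Δ^-subsample n (a ∘ suc) Δ^-tail-a b b′) k ⟩
        0# ∎

-- Constructive order arithmetic.

module OrderedFieldProperties {c ℓ₁ ℓ₂ ℓ₃} (R : ArchimedeanOrderedField c ℓ₁ ℓ₂ ℓ₃) where
  open ArchimedeanOrderedField R
  open FieldProperties heytingField public
  open IsStrictPartialOrder isStrictPartialOrder public using (<-respʳ-≈; <-respˡ-≈)
    renaming (irrefl to <-irrefl; trans to <-trans; asym to <-asym)

  -- The substitute for trichotomy. Cotransitivity of `#` separates `z` from `x` or from `y`; if `z`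
  -- lies on the outer side of one of them, transitivity through `x < y` gives the other
  -- alternative.
  <-cotrans : ∀ {x y} → x < y → ∀ z → x < z ⊎ z < y
  <-cotrans {x} {y} x<y z with #-cotrans (Equivalence.from #⇔<⊎> (inj₁ x<y)) z
  ... | inj₁ x#z = [ inj₁ , (λ z<x → inj₂ (<-trans z<x x<y)) ]′ (Equivalence.to #⇔<⊎> x#z)
  ... | inj₂ z#y = [ inj₂ , (λ y<z → inj₁ (<-trans x<y y<z)) ]′ (Equivalence.to #⇔<⊎> z#y)

  <⇒≤ : ∀ {x y} → x < y → x ≤ y
  <⇒≤ = <-asym

  ≤-respʳ-≈ : ∀ {x y z} → y ≈ z → x ≤ y → x ≤ z
  ≤-respʳ-≈ y≈z x≤y z<x = x≤y (<-respˡ-≈ (sym y≈z) z<x)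

  ≤-respˡ-≈ : ∀ {x y z} → x ≈ y → x ≤ z → y ≤ z
  ≤-respˡ-≈ x≈y x≤z z<y = x≤z (<-respʳ-≈ (sym x≈y) z<y)

  ≤-<-trans : ∀ {x y z} → x ≤ y → y < z → x < z
  ≤-<-trans {x} x≤y y<z = [ (λ y<x → contradiction y<x x≤y) , id ]′ (<-cotrans y<z x)

  <-≤-trans : ∀ {x y z} → x < y → y ≤ z → x < z
  <-≤-trans {z = z} x<y y≤z = [ id , (λ z<y → contradiction z<y y≤z) ]′ (<-cotrans x<y z)

  ≤-trans : ∀ {x y z} → x ≤ y → y ≤ z → x ≤ z
  ≤-trans x≤y y≤z z<x = y≤z (<-≤-trans z<x x≤y)

  +-monoʳ-≤ : ∀ x {y z} → y ≤ z → x + y ≤ x + z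
  +-monoʳ-≤ x {y} {z} y≤z x+z<x+y = y≤z (<-respˡ-≈ (cancel z) (<-respʳ-≈ (cancel y) (+-monoʳ-< (- x) x+z<x+y)))
    where
    cancel : ∀ y → - x + (x + y) ≈ y
    cancel y = trans (sym (+-assoc _ _ _)) (trans (+-congʳ (-‿inverseˡ x)) (+-identityˡ y))

  +-mono-≤ : ∀ {x y z w} → x ≤ y → z ≤ w → x + z ≤ y + w
  +-mono-≤ {x} {y} {z} {w} x≤y z≤w = ≤-trans (+-monoʳ-≤ x z≤w)
    (≤-respˡ-≈ (+-comm w x) (≤-respʳ-≈ (+-comm w y) (+-monoʳ-≤ w x≤y)))

  *-monoˡ-< : ∀ {x y z} → 0# < z → x < y → x * z < y * z
  *-monoˡ-< {x} {y} {z} 0<z x<y = <-respˡ-≈ (+-identityʳ (x * z)) (<-respʳ-≈ (x+[y-x]≈y (x * z) (y * z))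
    (+-monoʳ-< (x * z) (<-respʳ-≈ ([y-z]x≈yx-zx z y x) (*-positive 0<y-x 0<z))))
    where
    0<y-x : 0# < y - x
    0<y-x = <-respˡ-≈ (-‿inverseˡ x) (<-respʳ-≈ (+-comm (- x) y) (+-monoʳ-< (- x) x<y))

  *-cancelʳ-≤ : ∀ {x y z} → 0# < z → x * z ≤ y * z → x ≤ y
  *-cancelʳ-≤ 0<z xz≤yz y<x = xz≤yz (*-monoˡ-< 0<z y<x)

  >⇒# : ∀ {x} → 0# < x → x # 0#
  >⇒# 0<x = Equivalence.from #⇔<⊎> (inj₂ 0<x)

  -- An inverse is itself invertible, hence apart from 0; were it negative, multiplication by `x`
  -- would give 1 < 0.
  ⁻¹-positive : ∀ {x} (0<x : 0# < x) → 0# < x ⁻¹[ >⇒# 0<x ]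
  ⁻¹-positive {x} 0<x with Equivalence.to #⇔<⊎> x⁻¹#0
    where
    x⁻¹#0 : x ⁻¹[ >⇒# 0<x ] # 0#
    x⁻¹#0 = invertibleˡ⇒# (x , trans (*-congˡ (x-0≈x _)) (*-inverseʳ (>⇒# 0<x)))
  ... | inj₂ 0<x⁻¹ = 0<x⁻¹
  ... | inj₁ x⁻¹<0 = contradiction 1<0 (<-asym 0<1)
    where
    1<0 : 1# < 0#
    1<0 = <-respˡ-≈ (trans (*-comm _ x) (*-inverseʳ (>⇒# 0<x))) (<-respʳ-≈ (zeroˡ x) (*-monoˡ-< 0<x x⁻¹<0))

  *-cancelʳ-< : ∀ {x y z} → 0# < z → x * z < y * z → x < y
  *-cancelʳ-< {x} {y} {z} 0<z xz<yz = <-respˡ-≈ (cancel x) (<-respʳ-≈ (cancel y) (*-monoˡ-< (⁻¹-positive 0<z) xz<yz))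
    where
    cancel : ∀ x → x * z * z ⁻¹[ >⇒# 0<z ] ≈ x
    cancel x = trans (*-assoc _ _ _) (trans (*-congˡ (*-inverseʳ (>⇒# 0<z))) (*-identityʳ x))

  *-monoˡ-≤ : ∀ {x y z} → 0# < z → x ≤ y → x * z ≤ y * z
  *-monoˡ-≤ 0<z x≤y yz<xz = x≤y (*-cancelʳ-< 0<z yz<xz)

  -- If `y < x`, then y + x is positive, so y (y + x) < x (y + x), although the two products agree
  -- when the squares do.
  square-cancel-≤ : ∀ {x y} → 0# ≤ y → x * x ≈ y * y → x ≤ y
  square-cancel-≤ {x} {y} 0≤y xx≈yy y<x = <-irrefl
    (begin
      y * (y + x)    ≈⟨ distribˡ y y x ⟩
      y * y + y * x  ≈⟨ +-cong (sym xx≈yy) (*-comm y x) ⟩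
      x * x + x * y  ≈⟨ +-comm _ _ ⟩
      x * y + x * x  ≈⟨ distribˡ x y x ⟨
      x * (y + x)    ∎)
    (*-monoˡ-< 0<y+x y<x)
    where
    open ≈-Reasoning setoid
    0<y+x : 0# < y + x
    0<y+x = ≤-<-trans 0≤y (<-respˡ-≈ (+-identityʳ y) (+-monoʳ-< y (≤-<-trans 0≤y y<x)))

  fromℕ-nonneg : ∀ n → 0# ≤ fromℕ n
  fromℕ-nonneg zero    = <-irrefl refl
  fromℕ-nonneg (suc n) = ≤-respˡ-≈ (+-identityʳ 0#) (+-mono-≤ (<⇒≤ 0<1) (fromℕ-nonneg n))

  fromℕ-mono-≤ : ∀ {m n} → m ℕ.≤ n → fromℕ m ≤ fromℕ n
  fromℕ-mono-≤ {n = n} z≤n = fromℕ-nonneg n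
  fromℕ-mono-≤ (s≤s m≤n)   = +-monoʳ-≤ 1# (fromℕ-mono-≤ m≤n)

  fromℕ-positive : ∀ n → .{{NonZero n}} → 0# < fromℕ n
  fromℕ-positive (suc n) = <-≤-trans 0<1 (≤-respˡ-≈ (+-identityʳ 1#) (+-monoʳ-≤ 1# (fromℕ-nonneg n)))

-- Bounds on absolute values and rates of growth.

module Asymptotics {c ℓ₁ ℓ₂ ℓ₃ c′ ℓ₁′ ℓ₂′}
  {R : ArchimedeanOrderedField c ℓ₁ ℓ₂ ℓ₃} (K : ValuedField R c′ ℓ₁′ ℓ₂′) where
  open Analysis K
  open FieldProperties heytingField
  open SeriesProperties K
  private
    module R where
      open ArchimedeanOrderedField R public
      open OrderedFieldProperties R public

  infix 4 ∣_∣≤_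
  -- Natural bounds keep the growth estimates inside ℕ; the record lets unification recover `x` and
  -- `M`.
  record ∣_∣≤_ (x : Carrier) (M : ℕ) : Set ℓ₃ where
    constructor bounded
    field
      bound : ∣ x ∣ R.≤ R.fromℕ M
  open ∣_∣≤_ public

  ∣∣≤-resp-≈ : ∀ {x y M} → x ≈ y → ∣ x ∣≤ M → ∣ y ∣≤ M
  ∣∣≤-resp-≈ x≈y (bounded ∣x∣≤M) = bounded (R.≤-respˡ-≈ (∣∣-cong x≈y) ∣x∣≤M)

  ∣∣≤-weaken : ∀ {x M N} → M ℕ.≤ N → ∣ x ∣≤ M → ∣ x ∣≤ N
  ∣∣≤-weaken M≤N (bounded ∣x∣≤M) = bounded (R.≤-trans ∣x∣≤M (R.fromℕ-mono-≤ M≤N))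

  ∣∣≤-exists : ∀ x → ∃[ M ] ∣ x ∣≤ M
  ∣∣≤-exists x with R.archimedean ∣ x ∣
  ... | M , ∣x∣<M = M , bounded (R.<⇒≤ ∣x∣<M)

  ∣∣≤-+ : ∀ {x y M N} → ∣ x ∣≤ M → ∣ y ∣≤ N → ∣ x + y ∣≤ M ℕ.+ N
  ∣∣≤-+ {x} {y} {M} {N} (bounded ∣x∣≤M) (bounded ∣y∣≤N) = bounded (R.≤-trans (∣∣-triangle x y)
    (R.≤-respʳ-≈ (R.sym (R.fromℕ-+ M N)) (R.+-mono-≤ ∣x∣≤M ∣y∣≤N)))

  -- By multiplicativity the two absolute values have the same square.
  ∣-x∣≤∣x∣ : ∀ x → ∣ - x ∣ R.≤ ∣ x ∣
  ∣-x∣≤∣x∣ x = R.square-cancel-≤ (∣∣-nonneg x) (begin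
    ∣ - x ∣ R.* ∣ - x ∣  ≈⟨ ∣∣-* (- x) (- x) ⟨
    ∣ - x * - x ∣        ≈⟨ ∣∣-cong (trans (sym (-‿distribˡ-* x (- x)))
                              (trans (-‿cong (sym (-‿distribʳ-* x x))) (-‿involutive (x * x)))) ⟩
    ∣ x * x ∣            ≈⟨ ∣∣-* x x ⟩
    ∣ x ∣ R.* ∣ x ∣      ∎)
    where open ≈-Reasoning R.setoid

  ∣∣≤-minus : ∀ {x y M N} → ∣ x ∣≤ M → ∣ y ∣≤ N → ∣ x - y ∣≤ M ℕ.+ N
  ∣∣≤-minus {y = y} ∣x∣≤M (bounded ∣y∣≤N) = ∣∣≤-+ ∣x∣≤M (bounded (R.≤-trans (∣-x∣≤∣x∣ y) ∣y∣≤N))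

  ∣x*fromℕ∣ : ∀ x n → ∣ x * fromℕ n ∣ R.≈ ∣ x ∣ R.* R.fromℕ n
  ∣x*fromℕ∣ x n = R.trans (∣∣-* x (fromℕ n)) (R.*-congˡ (∣fromℕ∣ n))

  ∣∣≤-cancel-* : ∀ {x M} n → .{{NonZero n}} → ∣ x * fromℕ n ∣≤ M ℕ.* n → ∣ x ∣≤ M
  ∣∣≤-cancel-* {x} {M} n (bounded ∣xn∣≤Mn) = bounded (R.*-cancelʳ-≤ (R.fromℕ-positive n)
    (R.≤-respˡ-≈ (∣x*fromℕ∣ x n) (R.≤-respʳ-≈ (R.fromℕ-* M n) ∣xn∣≤Mn)))

  -- Discrete integration: each summation raises the exponent by one.
  Δ^-bounded⇒polynomial-growth : ∀ p f → (∃[ M ] ∀ k → ∣ Δ^ p f k ∣≤ M) → ∃[ M ] ∀ k → ∣ f k ∣≤ M ℕ.* suc k ℕ.^ p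
  Δ^-bounded⇒polynomial-growth zero    f (M , u≤M) = M , λ k → ∣∣≤-weaken (ℕ.≤-reflexive (≡.sym (ℕ.*-identityʳ M))) (u≤M k)
  Δ^-bounded⇒polynomial-growth (suc p) f Δᵖ-bounded with Δ^-bounded⇒polynomial-growth p (Δ f) Δᵖ-bounded | ∣∣≤-exists (f 0)
  -- `M₀` pays for the initial value and `M` for the increments. The induction on k uses (k + 1)ᵖ⁺¹
  -- + (k + 1)ᵖ = (k + 2) (k + 1)ᵖ ≤ (k + 2)ᵖ⁺¹.
  ... | M , Δf-bound | M₀ , f₀-bound = M₀ ℕ.+ M , go
    where
    inequality : ∀ k → (M₀ ℕ.+ M) ℕ.* suc k ℕ.^ suc p ℕ.+ M ℕ.* suc k ℕ.^ p ℕ.≤ (M₀ ℕ.+ M) ℕ.* suc (suc k) ℕ.^ suc p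
    inequality k = begin
      (M₀ ℕ.+ M) ℕ.* suc k ℕ.^ suc p ℕ.+ M ℕ.* suc k ℕ.^ p
        ≤⟨ ℕ.+-monoʳ-≤ _ (ℕ.*-monoˡ-≤ (suc k ℕ.^ p) (ℕ.m≤n+m M M₀)) ⟩
      (M₀ ℕ.+ M) ℕ.* suc k ℕ.^ suc p ℕ.+ (M₀ ℕ.+ M) ℕ.* suc k ℕ.^ p
        ≡⟨ solve 3 (λ M s q → M :* (s :* q) :+ M :* q := M :* ((con 1 :+ s) :* q)) ≡.refl (M₀ ℕ.+ M) (suc k) (suc k ℕ.^ p) ⟩
      (M₀ ℕ.+ M) ℕ.* (suc (suc k) ℕ.* suc k ℕ.^ p)
        ≤⟨ ℕ.*-monoʳ-≤ (M₀ ℕ.+ M) (ℕ.*-monoʳ-≤ (suc (suc k)) (ℕ.^-monoˡ-≤ p (ℕ.n≤1+n (suc k)))) ⟩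
      (M₀ ℕ.+ M) ℕ.* suc (suc k) ℕ.^ suc p ∎
      where
      open ℕ.≤-Reasoning
    go : ∀ k → ∣ f k ∣≤ (M₀ ℕ.+ M) ℕ.* suc k ℕ.^ suc p
    go zero    = ∣∣≤-weaken M₀≤ f₀-bound
      where
      M₀≤ : M₀ ℕ.≤ (M₀ ℕ.+ M) ℕ.* 1 ℕ.^ suc p
      M₀≤ rewrite ℕ.^-zeroˡ (suc p) | ℕ.*-identityʳ (M₀ ℕ.+ M) = ℕ.m≤m+n M₀ M
    go (suc k) = ∣∣≤-weaken (inequality k) (∣∣≤-resp-≈ (x+[y-x]≈y (f k) (f (suc k))) (∣∣≤-+ (go k) (Δf-bound k)))

  O[1/b] : ((b : ℕ) → .{{NonZero b}} → Carrier) → Set ℓ₃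
  O[1/b] u = ∃[ M ] ∀ b → .{{_ : NonZero b}} → ∣ u b * fromℕ b ∣≤ M

  -- The bound may depend on the index: a coefficient of `[1-x]· f` involves at most two
  -- coefficients of `f`.
  [1-x]^-O[1/b] : (E : (b : ℕ) → .{{NonZero b}} → Series) → (∀ k → O[1/b] (λ b → E b k)) →
    ∀ m k → O[1/b] (λ b → ([1-x]^ m · E b) k)
  [1-x]^-O[1/b] E E-small zero    k = E-small k
  [1-x]^-O[1/b] E E-small (suc m) k = [1-x]^-O[1/b] (λ b → [1-x]· E b) step m k
    where
    step : ∀ k → O[1/b] (λ b → ([1-x]· E b) k)
    step zero with E-small 0
    ... | M , u≤M = M , λ b → ∣∣≤-resp-≈ (*-congʳ (sym (x-0≈x (E b 0)))) (u≤M b)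
    step (suc k) with E-small (suc k) | E-small k
    ... | M , u≤M | M′ , u′≤M′ = M ℕ.+ M′ , λ b →
      ∣∣≤-resp-≈ (sym ([y-z]x≈yx-zx (fromℕ b) (E b (suc k)) (E b k))) (∣∣≤-minus (u≤M b) (u′≤M′ b))

  O[1/b]⇒⟶ : ∀ u ℓ → O[1/b] (λ b → u b - ℓ) → u ⟶ ℓ
  -- With N above M / ε and b ≥ N, the error times b is at most M < N ε ≤ b ε, and b cancels.
  O[1/b]⇒⟶ u ℓ (M , u≤M) ε 0<ε with R.archimedean (R.fromℕ M R.* ε R.⁻¹[ R.>⇒# 0<ε ])
  ... | N , M/ε<N = N , λ b N≤b → R.*-cancelʳ-< (R.fromℕ-positive b)
    (R.≤-<-trans (R.≤-respˡ-≈ (∣x*fromℕ∣ (u b - ℓ) b) (bound (u≤M b)))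
      (R.<-≤-trans M<Nε (R.≤-respʳ-≈ (R.*-comm (R.fromℕ b) ε) (R.*-monoˡ-≤ 0<ε (R.fromℕ-mono-≤ N≤b)))))
    where
    open ≈-Reasoning R.setoid
    M<Nε : R.fromℕ M R.< R.fromℕ N R.* ε
    M<Nε = R.<-respˡ-≈ (begin
      R.fromℕ M R.* ε R.⁻¹[ R.>⇒# 0<ε ] R.* ε    ≈⟨ R.*-assoc _ _ _ ⟩
      R.fromℕ M R.* (ε R.⁻¹[ R.>⇒# 0<ε ] R.* ε)  ≈⟨ R.*-congˡ (R.trans (R.*-comm _ _) (R.*-inverseʳ (R.>⇒# 0<ε))) ⟩
      R.fromℕ M R.* R.1#                         ≈⟨ R.*-identityʳ _ ⟩
      R.fromℕ M                                  ∎) (R.*-monoˡ-< 0<ε M/ε<N)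

  -- Convergence of the normalised coefficients.

  module _ (n : ℕ) .{{_ : NonZero n}} (h : Polynomial (suc n)) (h[1]#0 : eval h 1# # 0#)
    (a : Series) (a-series : a IsSeriesOf h /[1-x]^ suc n) where
    open ≈-Reasoning setoid

    private
      L L⁻¹ n!⁻¹ : Carrier
      L    = eval h 1#
      L⁻¹  = L ⁻¹[ h[1]#0 ]
      n!⁻¹ = fromℕ (n !) ⁻¹[ fromℕ#0 (n !) {{n !≢0}} ]

      -- Literally the inverse to which the division in the theorem unfolds, so the two formulations
      -- agree by definition.
      scale : (b : ℕ) → .{{NonZero b}} → Carrier
      scale b = (fromℕ (b ℕ.^ n) * L) ⁻¹[ x#0y#0→xy#0 (fromℕ#0 (b ℕ.^ n) {{m^n≢0 b n}}) h[1]#0 ]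

    deviation : Series
    deviation m = a m * L⁻¹ - fromℕ (m ℕ.^ n) * n!⁻¹

    -- Both terms are normalised to have n-th difference 1 at positive indices.
    Δ^-deviation : ∀ k → Δ^ n (deviation ∘ suc) k ≈ 0#
    Δ^-deviation k = begin
      Δ^ n (deviation ∘ suc) k
        ≈⟨ Lin.minus-homo (Δ^-isLinear n) (λ k → a (suc k) * L⁻¹) (λ k → fromℕ (suc k ℕ.^ n) * n!⁻¹) k ⟩
      Δ^ n (λ k → a (suc k) * L⁻¹) k - Δ^ n (λ k → fromℕ (suc k ℕ.^ n) * n!⁻¹) k
        ≈⟨ +-cong leading₁ (-‿cong leading₂) ⟩
      1# - 1#
        ≈⟨ -‿inverseʳ 1# ⟩
      0# ∎
      where
      leading₁ : Δ^ n (λ k → a (suc k) * L⁻¹) k ≈ 1#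
      leading₁ = trans (Lin.*-homo (Δ^-isLinear n) (a ∘ suc) L⁻¹ k)
        (trans (*-congʳ (Δ^-tail-a n h a a-series k)) (*-inverseʳ h[1]#0))
      leading₂ : Δ^ n (λ k → fromℕ (suc k ℕ.^ n) * n!⁻¹) k ≈ 1#
      leading₂ = trans (Lin.*-homo (Δ^-isLinear n) (λ k → fromℕ (suc k ℕ.^ n)) n!⁻¹ k)
        (trans (*-congʳ (trans (reflexive (≡.sym (Δ^-tail n (λ k → fromℕ (k ℕ.^ n)) k))) (Δ^-power n (suc k))))
          (*-inverseʳ (fromℕ#0 (n !) {{n !≢0}})))

    -- The n-th difference vanishes, so the one of order p = n - 1 is constant, hence bounded, and
    -- `deviation` grows at most like a p-th power. This controls positive indices only; for k = 0
    -- the index b k is 0 whatever b is. As `n` is a module parameter, `p` comes with an equation.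
    deviation-bound : ∀ p → n ≡ suc p → ∀ k → ∃[ M ] ∀ b → .{{NonZero b}} → ∣ deviation (b ℕ.* k) ∣≤ M ℕ.* b ℕ.^ p
    deviation-bound p n≡1+p zero with ∣∣≤-exists (deviation 0)
    ... | M , u≤M = M , λ b → ∣∣≤-resp-≈ (reflexive (≡.cong deviation (≡.sym (ℕ.*-zeroʳ b))))
      (∣∣≤-weaken (ℕ.m≤m*n M (b ℕ.^ p) {{m^n≢0 b p}}) u≤M)
    deviation-bound p n≡1+p (suc k) with Δ^-bounded⇒polynomial-growth p (deviation ∘ suc) Δᵖ-bounded
      where
      Δ-top : ∀ k → Δ (Δ^ p (deviation ∘ suc)) k ≈ 0#
      Δ-top k = trans (reflexive (≡.trans (≡.sym (Δ^-suc p (deviation ∘ suc) k))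
        (≡.cong (λ n → Δ^ n (deviation ∘ suc) k) (≡.sym n≡1+p)))) (Δ^-deviation k)
      constant : ∀ k → Δ^ p (deviation ∘ suc) 0 ≈ Δ^ p (deviation ∘ suc) k
      constant zero    = refl
      constant (suc k) = trans (constant k) (sym (trans (x-y≈z⇒x≈y+z (Δ-top k)) (+-identityʳ _)))
      Δᵖ-bounded : ∃[ M ] ∀ k → ∣ Δ^ p (deviation ∘ suc) k ∣≤ M
      Δᵖ-bounded with ∣∣≤-exists (Δ^ p (deviation ∘ suc) 0)
      ... | M , u≤M = M , λ k → ∣∣≤-resp-≈ (constant k) u≤M
    ... | M , u≤M = M ℕ.* suc k ℕ.^ p , at
      where
      at : ∀ b → .{{NonZero b}} → ∣ deviation (b ℕ.* suc k) ∣≤ M ℕ.* suc k ℕ.^ p ℕ.* b ℕ.^ p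
      -- `b * suc k` computes to the successor of `k + b′ * suc k`.
      at b@(suc b′) = ∣∣≤-weaken (ℕ.≤-reflexive rearrange) (u≤M (k ℕ.+ b′ ℕ.* suc k))
        where
        rearrange : M ℕ.* (b ℕ.* suc k) ℕ.^ p ≡ M ℕ.* suc k ℕ.^ p ℕ.* b ℕ.^ p
        rearrange = ≡.trans (≡.cong (M ℕ.*_) (≡.trans (^-distribʳ-* p b (suc k)) (ℕ.*-comm (b ℕ.^ p) (suc k ℕ.^ p))))
          (≡.sym (ℕ.*-assoc M (suc k ℕ.^ p) (b ℕ.^ p)))

    error : (b : ℕ) → .{{NonZero b}} → Series
    error b k = a (b ℕ.* k) * scale b - fromℕ (k ℕ.^ n) * n!⁻¹

    -- The factor bⁿ turns `scale b` into 1 / h(1), by uniqueness of inverses, and kⁿ into (b k)ⁿ.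
    error-scaled : ∀ b → .{{_ : NonZero b}} → ∀ k → error b k * fromℕ (b ℕ.^ n) ≈ deviation (b ℕ.* k)
    error-scaled b k = trans ([y-z]x≈yx-zx bⁿ _ _) (+-cong first (-‿cong second))
      where
      bⁿ : Carrier
      bⁿ = fromℕ (b ℕ.^ n)
      bⁿ*scale : bⁿ * scale b ≈ L⁻¹
      bⁿ*scale = *-inverse-unique (begin
        L * (bⁿ * scale b)  ≈⟨ *-assoc L bⁿ (scale b) ⟨
        L * bⁿ * scale b    ≈⟨ *-congʳ (*-comm L bⁿ) ⟩
        bⁿ * L * scale b    ≈⟨ *-inverseʳ (x#0y#0→xy#0 (fromℕ#0 (b ℕ.^ n) {{m^n≢0 b n}}) h[1]#0) ⟩
        1#                  ∎) (*-inverseʳ h[1]#0)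
      first : a (b ℕ.* k) * scale b * bⁿ ≈ a (b ℕ.* k) * L⁻¹
      first = trans (*-assoc _ _ _) (*-congˡ (trans (*-comm _ _) bⁿ*scale))
      second : fromℕ (k ℕ.^ n) * n!⁻¹ * bⁿ ≈ fromℕ ((b ℕ.* k) ℕ.^ n) * n!⁻¹
      second = begin
        fromℕ (k ℕ.^ n) * n!⁻¹ * bⁿ         ≈⟨ xy*z≈xz*y _ _ _ ⟩
        fromℕ (k ℕ.^ n) * bⁿ * n!⁻¹         ≈⟨ *-congʳ (trans (*-comm _ _) (sym (fromℕ-* (b ℕ.^ n) (k ℕ.^ n)))) ⟩
        fromℕ (b ℕ.^ n ℕ.* k ℕ.^ n) * n!⁻¹  ≈⟨ *-congʳ (fromℕ-cong (^-distribʳ-* n b k)) ⟨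
        fromℕ ((b ℕ.* k) ℕ.^ n) * n!⁻¹      ∎

    -- The error times bᵖ⁺¹ is the deviation at b k, bounded by a multiple of bᵖ; cancelling bᵖ
    -- leaves one factor b.
    error-O[1/b] : ∀ p → n ≡ suc p → ∀ k → O[1/b] (λ b → error b k)
    error-O[1/b] p n≡1+p k with deviation-bound p n≡1+p k
    ... | M , u≤M = M , λ b → ∣∣≤-cancel-* (b ℕ.^ p) {{m^n≢0 b p}} (∣∣≤-resp-≈ (sym (begin
      error b k * fromℕ b * fromℕ (b ℕ.^ p)    ≈⟨ *-assoc _ _ _ ⟩
      error b k * (fromℕ b * fromℕ (b ℕ.^ p))  ≈⟨ *-congˡ (fromℕ-* b (b ℕ.^ p)) ⟨
      error b k * fromℕ (b ℕ.^ suc p)          ≡⟨ ≡.cong (λ n → error b k * fromℕ (b ℕ.^ n)) (≡.sym n≡1+p) ⟩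
      error b k * fromℕ (b ℕ.^ n)              ≈⟨ error-scaled b k ⟩
      deviation (b ℕ.* k)                      ∎)) (u≤M b))

    -- By linearity, (1 - x)ⁿ⁺¹ applied to `error b` is coefficientwise the difference between the
    -- normalised `h⟨ b ⟩` and its limit: the first term by the assumption on `h⟨ b ⟩`, the second
    -- by `worpitzky`.
    coefficients-converge : (h⟨_⟩ : ℕ → Polynomial (suc n)) →
      (∀ b → .{{_ : NonZero b}} → (λ k → a (b ℕ.* k)) IsSeriesOf h⟨ b ⟩ /[1-x]^ suc n) →
      ∀ j → (λ b → coeff h⟨ b ⟩ j * scale b) ⟶ fromℕ (eulerianCoeff n j) * n!⁻¹
    coefficients-converge h⟨_⟩ h⟨⟩-series j = O[1/b]⇒⟶ _ _ (small (ℕ.suc-pred n))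
      where
      coefficient-error : ∀ b → .{{_ : NonZero b}} →
        ([1-x]^ suc n · error b) j ≈ coeff h⟨ b ⟩ j * scale b - fromℕ (eulerianCoeff n j) * n!⁻¹
      coefficient-error b = begin
        ([1-x]^ suc n · error b) j
          ≈⟨ T.minus-homo (λ k → a (b ℕ.* k) * scale b) (λ k → fromℕ (k ℕ.^ n) * n!⁻¹) j ⟩
        ([1-x]^ suc n · (λ k → a (b ℕ.* k) * scale b)) j - ([1-x]^ suc n · (λ k → fromℕ (k ℕ.^ n) * n!⁻¹)) j
          ≈⟨ +-cong (trans (T.*-homo (λ k → a (b ℕ.* k)) (scale b) j) (*-congʳ (h⟨⟩-series b j)))
               (-‿cong (trans (T.*-homo (λ k → fromℕ (k ℕ.^ n)) n!⁻¹ j) (*-congʳ (worpitzky n j)))) ⟩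
        coeff h⟨ b ⟩ j * scale b - fromℕ (eulerianCoeff n j) * n!⁻¹ ∎
        where module T = IsLinear ([1-x]^-isLinear (suc n))
      small : ∀ {p} → suc p ≡ n → O[1/b] (λ b → coeff h⟨ b ⟩ j * scale b - fromℕ (eulerianCoeff n j) * n!⁻¹)
      small {p} 1+p≡n with [1-x]^-O[1/b] error (error-O[1/b] p (≡.sym 1+p≡n)) (suc n) j
      ... | M , u≤M = M , λ b → ∣∣≤-resp-≈ (*-congʳ (coefficient-error b)) (u≤M b)

theorem5p1 : ∀ {c ℓ₁ ℓ₂ ℓ₃ c′ ℓ₁′ ℓ₂′}
    (R : ArchimedeanOrderedField c ℓ₁ ℓ₂ ℓ₃) (K : ValuedField R c′ ℓ₁′ ℓ₂′) →
    let open Analysis K in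
    (n : ℕ) .{{_ : NonZero n}} (h : Polynomial (suc n)) (h[1]#0 : eval h 1# # 0#)
    (a : Series) → a IsSeriesOf h /[1-x]^ suc n →
    (∀ b → .{{_ : NonZero b}} →
    ∃! _≋_ λ (g : Polynomial (suc n)) → (λ k → a (b ℕ.* k)) IsSeriesOf g /[1-x]^ suc n)
    ×
    (∀ (h⟨_⟩ : ℕ → Polynomial (suc n)) →
    (∀ b → .{{_ : NonZero b}} → (λ k → a (b ℕ.* k)) IsSeriesOf h⟨ b ⟩ /[1-x]^ suc n) →
    ∀ j →
    (λ b → coeff h⟨ b ⟩ j / fromℕ (b ℕ.^ n) * eval h 1# [ x#0y#0→xy#0 (fromℕ#0 (b ℕ.^ n) {{m^n≢0 b n}}) h[1]#0 ])
    ⟶ fromℕ (eulerianCoeff n j) / fromℕ (n !) [ fromℕ#0 (n !) {{n !≢0}} ])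
theorem5p1 R K n h h[1]#0 a a-series =
  SeriesProperties.subsample-expansion K n h a a-series ,
  Asymptotics.coefficients-converge K n h h[1]#0 a a-series
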